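{- For the submodular bin packing problem (SMBP) with jobs $1,\dots,N$ arriving online in an arbitrary order, any lazy algorithm purchases at most $\frac{8}{3}\,\mathrm{OPT}$ machines, where $\mathrm{OPT}$ is the minimum number of machines needed to serve all the jobs.
   Context: Submodular bin packing (SMBP): each job $j\in\{1,\dots,N\}$ has two parameters $\mu_j\ge 0$ and $b_j\ge 0$. All machines have the same capacity $V>0$, and $D=D(\alpha)\ge 0$ is a given constant. A set $S$ of jobs is feasible (can be assigned to one machine) if $$\sum_{j\in S}\mu_j + D\sqrt{\sum_{j\in S} b_j}\le V .$$ Every job must be assigned to exactly one machine, the set of jobs on each machine must be feasible, and the goal is to minimize the number of machines used. Every single job is assumed feasible on its own, so that a feasible assignment exists. (By rescaling the $\mu_j$ and $b_j$ one may equivalently take $V=1$ and $D=1$.) Online setting: jobs arrive one at a time, each must be assigned irrevocably to a machine upon arrival, and jobs are never removed. An online algorithm is lazy if, upon arrival of a new job, it assigns the job to one of the already purchased machines whenever this can be done without violating the capacity constraint; i.e., it purchases a new machine if and only if none of the existing machines can accommodate the newly arrived job. -}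

module Defs where

open import Data.Bool.Base using (if_then_else_)
open import Data.Fin.Base using (Fin; zero; suc)
open import Data.Fin.Permutation using (Permutation′; _⟨$⟩ʳ_)
open import Data.Fin.Properties using () renaming (_≟_ to _≟ᶠ_)
open import Data.Fin.Subset using (Subset; inside; outside; ⁅_⁆; _∪_)
open import Data.Integer.Base as ℤ using (+_; -[1+_])
import Data.Integer.Properties as ℤₚ
open import Data.List.Base using (List; []; _∷_; tabulate)
open import Data.Nat.Base as ℕ using (ℕ; zero; suc; z≤n; s≤s)
import Data.Nat.Properties as ℕₚ
open import Data.Product.Base using (Σ; ∃; _×_; _,_; proj₁; proj₂)
open import Data.Rational.Base as ℚ using (ℚ; 0ℚ; 1ℚ; ½)
import Data.Rational.Properties as ℚₚ
open import Data.Rational.Solver using (module +-*-Solver)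
import Data.Rational.Unnormalised.Base as ℚᵘ
import Data.Rational.Unnormalised.Properties as ℚᵘₚ
open import Data.Sum.Base using (inj₁; inj₂)
open import Data.Vec.Base as Vec using (Vec; []; _∷_; _[_]≔_)
open import Function.Base using (_∘_)
open import Relation.Binary.PropositionalEquality
  using (_≡_; refl; sym; trans; cong; cong₂; subst; subst₂)
open import Relation.Nullary.Decidable using (Dec; yes; no; does)
open import Relation.Nullary.Negation using (¬_; contradiction)

module ℚ-Aux where
  open import Data.Rational.Base
  open ℚₚ
  open +-*-Solver using (solve; _:+_; _:*_; :-_; _:=_; con; _:-_)

  opaque
    *-nn : ∀ {p q} → 0ℚ ≤ p → 0ℚ ≤ q → 0ℚ ≤ p * q
    *-nn {p} {q} 0≤p 0≤q = nonNegative⁻¹ (p * q)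
      {{nonNeg*nonNeg⇒nonNeg p {{nonNegative 0≤p}} q {{nonNegative 0≤q}}}}

    +-nn : ∀ {p q} → 0ℚ ≤ p → 0ℚ ≤ q → 0ℚ ≤ p + q
    +-nn 0≤p 0≤q = +-mono-≤ 0≤p 0≤q

    *-pp : ∀ {p q} → 0ℚ < p → 0ℚ < q → 0ℚ < p * q
    *-pp {p} {q} 0<p 0<q = positive⁻¹ (p * q)
      {{pos*pos⇒pos p {{positive 0<p}} q {{positive 0<q}}}}

    *-mono : ∀ {p q r s} → 0ℚ ≤ p → 0ℚ ≤ s → p ≤ q → r ≤ s → p * r ≤ q * s
    *-mono {p} {q} {r} {s} 0≤p 0≤s p≤q r≤s = ≤-trans
      (*-monoˡ-≤-nonNeg p {{nonNegative 0≤p}} r≤s)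
      (*-monoʳ-≤-nonNeg s {{nonNegative 0≤s}} p≤q)

    0<½ : 0ℚ < ½
    0<½ = positive⁻¹ ½

    0<1 : 0ℚ < 1ℚ
    0<1 = positive⁻¹ 1ℚ

    p≤p+q : ∀ p {q} → 0ℚ ≤ q → p ≤ p + q
    p≤p+q p {q} 0≤q = subst (_≤ p + q) (+-identityʳ p) (+-monoʳ-≤ p 0≤q)

    q≤p+q : ∀ {p} q → 0ℚ ≤ p → q ≤ p + q
    q≤p+q {p} q 0≤p = subst (_≤ p + q) (+-identityˡ q) (+-monoˡ-≤ q 0≤p)

    p≤∣p∣ : ∀ p → p ≤ ∣ p ∣
    p≤∣p∣ p with ≤-total 0ℚ p
    ... | inj₁ 0≤p = ≤-reflexive (sym (0≤p⇒∣p∣≡p 0≤p))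
    ... | inj₂ p≤0 = ≤-trans p≤0 (0≤∣p∣ p)

    swap-∣-∣ : ∀ p q → ∣ p - q ∣ ≡ ∣ q - p ∣
    swap-∣-∣ p q = trans (cong ∣_∣ (solve 2 (λ p q → p :- q := :- (q :- p)) refl p q))
                         (∣-p∣≡∣p∣ (q - p))

    ∣-∣⇒≤ : ∀ {p q ε} → ∣ p - q ∣ ≤ ε → p ≤ q + ε
    ∣-∣⇒≤ {p} {q} {ε} h = subst (_≤ q + ε)
      (solve 2 (λ p q → q :+ (p :- q) := p) refl p q)
      (+-monoʳ-≤ q (≤-trans (p≤∣p∣ (p - q)) h))

    ≤⇒-≤ : ∀ {p q ε} → p ≤ q + ε → p - q ≤ ε
    ≤⇒-≤ {p} {q} {ε} h = subst (p - q ≤_)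
      (solve 2 (λ q ε → q :+ ε :- q := ε) refl q ε)
      (+-monoˡ-≤ (- q) h)

    ≤⇒∣-∣ : ∀ {p q ε} → p ≤ q + ε → q ≤ p + ε → ∣ p - q ∣ ≤ ε
    ≤⇒∣-∣ {p} {q} {ε} h k with ∣p∣≡p∨∣p∣≡-p (p - q)
    ... | inj₁ e = subst (_≤ ε) (sym e) (≤⇒-≤ h)
    ... | inj₂ e = subst (_≤ ε)
      (trans (solve 2 (λ p q → q :- p := :- (p :- q)) refl p q) (sym e)) (≤⇒-≤ k)

    ½ε+½ε : ∀ ε → ½ * ε + ½ * ε ≡ ε
    ½ε+½ε ε = trans (sym (*-distribʳ-+ ε ½ ½)) (*-identityˡ ε)

    *-1/ : ∀ B r ε → B * r ≡ 1ℚ → B * (ε * r) ≡ ε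
    *-1/ B r ε Br≡1 =
      trans (sym (*-assoc B ε r))
      (trans (cong (_* r) (*-comm B ε))
      (trans (*-assoc ε B r)
      (trans (cong (ε *_) Br≡1) (*-identityʳ ε))))

    div : ∀ ε B → 0ℚ < ε → 0ℚ < B → ∃ λ δ → 0ℚ < δ × B * δ ≡ ε
    div ε B 0<ε 0<B =
      let B⁻¹ = (1/ B) {{pos⇒nonZero B {{positive 0<B}}}} in
      ε * B⁻¹ ,
      *-pp {ε} {B⁻¹} 0<ε (positive⁻¹ B⁻¹ {{1/pos⇒pos B {{positive 0<B}}}}) ,
      *-1/ B B⁻¹ ε (*-inverseʳ B {{pos⇒nonZero B {{positive 0<B}}}})

    pq-p′q′ : ∀ p q p′ q′ → p * q - p′ * q′ ≡ p * (q - q′) + q′ * (p - p′)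
    pq-p′q′ = solve 4 (λ p q p′ q′ →
      p :* q :- p′ :* q′ := p :* (q :- q′) :+ q′ :* (p :- p′)) refl

    ∣pq-p′q′∣≤ : ∀ p q p′ q′ {A B δ γ} → 0ℚ ≤ δ → 0ℚ ≤ γ →
      ∣ p ∣ ≤ A → ∣ q′ ∣ ≤ B → ∣ q - q′ ∣ ≤ δ → ∣ p - p′ ∣ ≤ γ →
      ∣ p * q - p′ * q′ ∣ ≤ A * δ + B * γ
    ∣pq-p′q′∣≤ p q p′ q′ {A} {B} {δ} {γ} 0≤δ 0≤γ p≤A q′≤B q≤δ p≤γ =
      ≤-trans (≤-reflexive (cong ∣_∣ (pq-p′q′ p q p′ q′)))
      (≤-trans (∣p+q∣≤∣p∣+∣q∣ (p * (q - q′)) (q′ * (p - p′)))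
      (≤-trans (≤-reflexive (cong₂ _+_ (∣p*q∣≡∣p∣*∣q∣ p (q - q′)) (∣p*q∣≡∣p∣*∣q∣ q′ (p - p′))))
      (+-mono-≤
        (*-mono {∣ p ∣} {A} {∣ q - q′ ∣} {δ} (0≤∣p∣ p) 0≤δ p≤A q≤δ)
        (*-mono {∣ q′ ∣} {B} {∣ p - p′ ∣} {γ} (0≤∣p∣ q′) 0≤γ q′≤B p≤γ))))

    square-+-≤ : ∀ s u B δ → 0ℚ ≤ s → 0ℚ ≤ u → 0ℚ ≤ δ → s ≤ B → u ≤ δ → u ≤ 1ℚ →
      (s + u) * (s + u) ≤ s * s + (B + B + 1ℚ) * δ
    square-+-≤ s u B δ 0≤s 0≤u 0≤δ s≤B u≤δ u≤1 =
      ≤-trans (≤-reflexive (solve 2 (λ s u →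
        (s :+ u) :* (s :+ u) := s :* s :+ (s :+ s :+ u) :* u) refl s u))
      (+-monoʳ-≤ (s * s)
        (*-mono {s + s + u} {B + B + 1ℚ} {u} {δ} (+-nn (+-nn 0≤s 0≤s) 0≤u) 0≤δ
          (+-mono-≤ (+-mono-≤ s≤B s≤B) u≤1) u≤δ))

  opaque
    frac : ℕ → ℕ → ℚ
    frac k n = + k / suc n

    frac-≤ : ∀ {k l} m n → k ℕ.* suc n ℕ.≤ l ℕ.* suc m → frac k m ≤ frac l n
    frac-≤ {k} {l} m n h = toℚᵘ-cancel-≤
      (ℚᵘₚ.≤-respˡ-≃ (ℚᵘₚ.≃-sym (toℚᵘ-fromℚᵘ (ℚᵘ.mkℚᵘ (+ k) m)))
      (ℚᵘₚ.≤-respʳ-≃ (ℚᵘₚ.≃-sym (toℚᵘ-fromℚᵘ (ℚᵘ.mkℚᵘ (+ l) n)))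
      (ℚᵘ.*≤* (subst₂ ℤ._≤_ (ℤₚ.pos-* k (suc n)) (ℤₚ.pos-* l (suc m)) (ℤ.+≤+ h)))))

    frac-0 : ∀ n → frac 0 n ≡ 0ℚ
    frac-0 n = 0/n≡0 (suc n)

    frac-1 : frac 1 0 ≡ 1ℚ
    frac-1 = refl

    frac-suc : ∀ k n → frac (suc k) n ≤ frac k n + frac 1 n
    frac-suc k n = toℚᵘ-cancel-≤
      (ℚᵘₚ.≤-respˡ-≃ (ℚᵘₚ.≃-sym (toℚᵘ-fromℚᵘ (ℚᵘ.mkℚᵘ (+ suc k) n)))
      (ℚᵘₚ.≤-respʳ-≃ (ℚᵘₚ.≃-sym (ℚᵘₚ.≃-trans (toℚᵘ-homo-+ (+ k / suc n) (+ 1 / suc n))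
          (ℚᵘₚ.+-cong (toℚᵘ-fromℚᵘ (ℚᵘ.mkℚᵘ (+ k) n)) (toℚᵘ-fromℚᵘ (ℚᵘ.mkℚᵘ (+ 1) n)))))
      (ℚᵘ.*≤* (ℤₚ.≤-reflexive (lem (+ k) (+ suc n))))))
      where
      open import Data.Integer.Tactic.RingSolver using (solve-∀)
      lem : ∀ k s → (ℤ.1ℤ ℤ.+ k) ℤ.* (s ℤ.* s) ≡ (k ℤ.* s ℤ.+ ℤ.1ℤ ℤ.* s) ℤ.* s
      lem = solve-∀

    p<⌈p⌉ : ∀ p → p < frac (suc ℤ.∣ ↥ p ∣) 0
    p<⌈p⌉ p@(mkℚ n d _) = toℚᵘ-cancel-<
      (ℚᵘₚ.<-respʳ-≃ (ℚᵘₚ.≃-sym (toℚᵘ-fromℚᵘ (ℚᵘ.mkℚᵘ (+ suc ℤ.∣ n ∣) 0)))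
      (ℚᵘ.*<* (lem n)))
      where
      lem : ∀ n → n ℤ.* + 1 ℤ.< + suc ℤ.∣ n ∣ ℤ.* + suc d
      lem (+ m) = subst (ℤ._< + suc m ℤ.* + suc d) (sym (ℤₚ.*-identityʳ (+ m)))
        (ℤ.+<+ (ℕₚ.<-≤-trans (ℕₚ.n<1+n m) (ℕₚ.m≤m*n (suc m) (suc d))))
      lem -[1+ m ] = ℤ.-<+

    archimedean : ∀ ε → 0ℚ < ε → ∃ λ N → ∀ n → N ℕ.≤ n → frac 1 n ≤ ε
    archimedean (mkℚ (+ 0) d _) (*<* (ℤ.+<+ ()))
    archimedean ε@(mkℚ (+ suc m) d _) _ = d , λ n d≤n → toℚᵘ-cancel-≤
      (ℚᵘₚ.≤-respˡ-≃ (ℚᵘₚ.≃-sym (toℚᵘ-fromℚᵘ (ℚᵘ.mkℚᵘ (+ 1) n)))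
      (ℚᵘ.*≤* (ℤ.+≤+ (ℕₚ.*-mono-≤ {1} {suc m} (s≤s z≤n) (s≤s d≤n)))))
    archimedean (mkℚ -[1+ m ] d _) (*<* ())

  0≤frac : ∀ k n → 0ℚ ≤ frac k n
  0≤frac k n = subst (_≤ frac k n) (frac-0 0) (frac-≤ 0 n z≤n)

open ℚ-Aux

-- The greatest k ≤ B satisfying P, or 0 if there is none.
greatest : {P : ℕ → Set} → (∀ k → Dec (P k)) → ℕ → ℕ
greatest P? zero    = zero
greatest P? (suc B) = if does (P? (suc B)) then suc B else greatest P? B

-- sqrtℚ n p is the greatest multiple of 1/(n+1) whose square is at most
-- max(p,0).  The search bound is large enough: its successor, divided by
-- n+1, is 1 + ∣ numerator ∣, which exceeds both max(p,0) and 1.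
opaque
  sqrtℚ : ℕ → ℚ → ℚ
  sqrtℚ n p = frac (greatest square≤? (n ℕ.+ ℤ.∣ ℚ.↥ p⁺ ∣ ℕ.* suc n)) n
    where
    p⁺ : ℚ
    p⁺ = p ℚ.⊔ 0ℚ
    square≤? : ∀ k → Dec (frac k n ℚ.* frac k n ℚ.≤ p⁺)
    square≤? k = frac k n ℚ.* frac k n ℚₚ.≤? p⁺

module Greatest-Aux where
  open import Data.Rational.Base
  open ℚₚ

  greatest-holds : ∀ {P : ℕ → Set} (P? : ∀ k → Dec (P k)) → P 0 → ∀ B → P (greatest P? B)
  greatest-holds P? P0 zero = P0
  greatest-holds P? P0 (suc B) with P? (suc B)
  ... | yes p = p
  ... | no  _ = greatest-holds P? P0 B

  greatest-max : ∀ {P : ℕ → Set} (P? : ∀ k → Dec (P k)) B → ¬ P (suc B) → ¬ P (suc (greatest P? B))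
  greatest-max P? zero    ¬p = ¬p
  greatest-max P? (suc B) ¬p with P? (suc B)
  ... | yes _  = ¬p
  ... | no ¬p′ = greatest-max P? B ¬p′

  module _ (n : ℕ) (p : ℚ) where
    private
      P : ℕ → Set
      P k = frac k n * frac k n ≤ p

      P? : ∀ k → Dec (P k)
      P? k = frac k n * frac k n ≤? p

      a = ℤ.∣ ↥ p ∣
      B = n ℕ.+ a ℕ.* suc n
      g = greatest P? B
      c = frac (suc a) 0
      d = frac (suc B) n
      e = frac (suc g) n

      0≤c : 0ℚ ≤ c
      0≤c = 0≤frac (suc a) 0

      0≤d : 0ℚ ≤ d
      0≤d = 0≤frac (suc B) n

      0≤e : 0ℚ ≤ e
      0≤e = 0≤frac (suc g) n

      1≤c : 1ℚ ≤ c
      1≤c = subst (_≤ c) frac-1 (frac-≤ {1} {suc a} 0 0 (s≤s z≤n))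

      c≤d : c ≤ d
      c≤d = frac-≤ {suc a} {suc B} 0 n (ℕₚ.≤-reflexive (sym (ℕₚ.*-identityʳ (suc B))))

      c≤d*d : c ≤ d * d
      c≤d*d = subst (_≤ d * d) (*-identityʳ c)
        (*-mono {c} {d} {1ℚ} {d} 0≤c 0≤d c≤d (≤-trans 1≤c c≤d))

      ¬P : ¬ P (suc B)
      ¬P h = <-irrefl refl (<-≤-trans (p<⌈p⌉ p) (≤-trans c≤d*d h))

      e≤ : e ≤ frac g n + frac 1 n
      e≤ = frac-suc g n

    greatest-square-upper : p < (frac g n + frac 1 n) * (frac g n + frac 1 n)
    greatest-square-upper = <-≤-trans (≰⇒> (greatest-max {P} P? B ¬P))
      (*-mono {e} {frac g n + frac 1 n} {e} {frac g n + frac 1 n}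
        0≤e (≤-trans 0≤e e≤) e≤ e≤)

open Greatest-Aux

opaque
  unfolding sqrtℚ

  sqrtℚ-nonneg : ∀ n p → 0ℚ ℚ.≤ sqrtℚ n p
  sqrtℚ-nonneg n p = 0≤frac _ n

  sqrtℚ-lower : ∀ n p → sqrtℚ n p ℚ.* sqrtℚ n p ℚ.≤ p ℚ.⊔ 0ℚ
  sqrtℚ-lower n p = greatest-holds {λ k → frac k n ℚ.* frac k n ℚ.≤ p ℚ.⊔ 0ℚ}
    (λ k → frac k n ℚ.* frac k n ℚₚ.≤? p ℚ.⊔ 0ℚ)
    (subst (ℚ._≤ p ℚ.⊔ 0ℚ) (sym (cong₂ ℚ._*_ (frac-0 n) (frac-0 n))) (ℚₚ.p≤q⊔p p 0ℚ))
    (n ℕ.+ ℤ.∣ ℚ.↥ (p ℚ.⊔ 0ℚ) ∣ ℕ.* suc n)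

  sqrtℚ-upper : ∀ n p → let s = sqrtℚ n p ℚ.+ frac 1 n in p ℚ.⊔ 0ℚ ℚ.< s ℚ.* s
  sqrtℚ-upper n p = greatest-square-upper n (p ℚ.⊔ 0ℚ)

IsCauchy : (ℕ → ℚ) → Set
IsCauchy s = ∀ ε → 0ℚ ℚ.< ε →
  ∃ λ N → ∀ m n → N ℕ.≤ m → N ℕ.≤ n → ℚ.∣ s m ℚ.- s n ∣ ℚ.≤ ε

-- A real number is represented by a Cauchy sequence of rationals; equality
-- of reals is _≃_ below, not _≡_.
record ℝ : Set where
  constructor mkℝ
  field
    seq    : ℕ → ℚ
    cauchy : IsCauchy seq
open ℝ public

infix 4 _≤_ _<_ _≃_

_≤_ : ℝ → ℝ → Set
x ≤ y = ∀ ε → 0ℚ ℚ.< ε → ∃ λ N → ∀ n → N ℕ.≤ n → seq x n ℚ.≤ seq y n ℚ.+ ε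

_<_ : ℝ → ℝ → Set
x < y = ∃ λ ε → 0ℚ ℚ.< ε × ∃ λ N → ∀ n → N ℕ.≤ n → seq x n ℚ.+ ε ℚ.≤ seq y n

_≃_ : ℝ → ℝ → Set
x ≃ y = x ≤ y × y ≤ x

0ℝ : ℝ
0ℝ = mkℝ (λ _ → 0ℚ) λ ε 0<ε → 0 , λ _ _ _ _ → ℚₚ.<⇒≤ 0<ε

module Cauchy-Aux where
  open ℚₚ
  open +-*-Solver using (solve; _:+_; _:*_; :-_; _:=_; con; _:-_)

  bounded : ∀ {s} → IsCauchy s →
    ∃ λ N → ∃ λ B → 0ℚ ℚ.< B × (∀ n → N ℕ.≤ n → ℚ.∣ s n ∣ ℚ.≤ B)
  bounded {s} c with c 1ℚ 0<1
  ... | N , h = N , 1ℚ ℚ.+ ℚ.∣ s N ∣ , <-≤-trans 0<1 (p≤p+q 1ℚ (0≤∣p∣ (s N))) ,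
    λ n N≤n → ≤-trans (≤-reflexive (cong ℚ.∣_∣
        (solve 2 (λ a b → a := (a :- b) :+ b) refl (s n) (s N))))
      (≤-trans (∣p+q∣≤∣p∣+∣q∣ (s n ℚ.- s N) (s N))
               (+-monoˡ-≤ ℚ.∣ s N ∣ (h n N N≤n ℕₚ.≤-refl)))

  +-cauchy : ∀ {s t} → IsCauchy s → IsCauchy t → IsCauchy (λ n → s n ℚ.+ t n)
  +-cauchy {s} {t} cs ct ε 0<ε
    with cs (½ ℚ.* ε) (*-pp 0<½ 0<ε) | ct (½ ℚ.* ε) (*-pp 0<½ 0<ε)
  ... | M , f | N , g = M ℕ.⊔ N , λ m n lm ln →
    ≤-trans (≤-reflexive (cong ℚ.∣_∣
        (solve 4 (λ a b a′ b′ → (a :+ b) :- (a′ :+ b′) := (a :- a′) :+ (b :- b′)) refl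
           (s m) (t m) (s n) (t n))))
    (≤-trans (∣p+q∣≤∣p∣+∣q∣ (s m ℚ.- s n) (t m ℚ.- t n))
    (≤-trans (+-mono-≤ (f m n (ℕₚ.m⊔n≤o⇒m≤o M N lm) (ℕₚ.m⊔n≤o⇒m≤o M N ln))
                       (g m n (ℕₚ.m⊔n≤o⇒n≤o M N lm) (ℕₚ.m⊔n≤o⇒n≤o M N ln)))
             (≤-reflexive (½ε+½ε ε))))

  *-estimate : ∀ {s t : ℕ → ℚ} {A B δ γ} K L M N → 0ℚ ℚ.≤ δ → 0ℚ ℚ.≤ γ →
    (∀ n → K ℕ.≤ n → ℚ.∣ s n ∣ ℚ.≤ A) → (∀ n → L ℕ.≤ n → ℚ.∣ t n ∣ ℚ.≤ B) →
    (∀ m n → M ℕ.≤ m → M ℕ.≤ n → ℚ.∣ t m ℚ.- t n ∣ ℚ.≤ δ) →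
    (∀ m n → N ℕ.≤ m → N ℕ.≤ n → ℚ.∣ s m ℚ.- s n ∣ ℚ.≤ γ) →
    ∀ m n → K ℕ.⊔ L ℕ.⊔ (M ℕ.⊔ N) ℕ.≤ m → K ℕ.⊔ L ℕ.⊔ (M ℕ.⊔ N) ℕ.≤ n →
    ℚ.∣ s m ℚ.* t m ℚ.- s n ℚ.* t n ∣ ℚ.≤ A ℚ.* δ ℚ.+ B ℚ.* γ
  *-estimate {s} {t} K L M N 0≤δ 0≤γ bs bt f g m n lm ln =
    ∣pq-p′q′∣≤ (s m) (t m) (s n) (t n) 0≤δ 0≤γ
      (bs m (ℕₚ.m⊔n≤o⇒m≤o K L lm₁)) (bt n (ℕₚ.m⊔n≤o⇒n≤o K L ln₁))
      (f m n (ℕₚ.m⊔n≤o⇒m≤o M N lm₂) (ℕₚ.m⊔n≤o⇒m≤o M N ln₂))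
      (g m n (ℕₚ.m⊔n≤o⇒n≤o M N lm₂) (ℕₚ.m⊔n≤o⇒n≤o M N ln₂))
    where
    lm₁ = ℕₚ.m⊔n≤o⇒m≤o (K ℕ.⊔ L) (M ℕ.⊔ N) lm
    lm₂ = ℕₚ.m⊔n≤o⇒n≤o (K ℕ.⊔ L) (M ℕ.⊔ N) lm
    ln₁ = ℕₚ.m⊔n≤o⇒m≤o (K ℕ.⊔ L) (M ℕ.⊔ N) ln
    ln₂ = ℕₚ.m⊔n≤o⇒n≤o (K ℕ.⊔ L) (M ℕ.⊔ N) ln

  *-cauchy : ∀ {s t} → IsCauchy s → IsCauchy t → IsCauchy (λ n → s n ℚ.* t n)
  *-cauchy {s} {t} cs ct ε 0<ε =
    let K , A , 0<A , bs = bounded {s} cs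
        L , B , 0<B , bt = bounded {t} ct
        0<h = *-pp {½} {ε} 0<½ 0<ε
        δ , 0<δ , Aδ = div (½ ℚ.* ε) A 0<h 0<A
        γ , 0<γ , Bγ = div (½ ℚ.* ε) B 0<h 0<B
        M , f = ct δ 0<δ
        N , g = cs γ 0<γ
    in K ℕ.⊔ L ℕ.⊔ (M ℕ.⊔ N) , λ m n lm ln →
      subst (ℚ.∣ s m ℚ.* t m ℚ.- s n ℚ.* t n ∣ ℚ.≤_) (trans (cong₂ ℚ._+_ Aδ Bγ) (½ε+½ε ε))
        (*-estimate {s} {t} K L M N (<⇒≤ 0<δ) (<⇒≤ 0<γ) bs bt f g m n lm ln)

open Cauchy-Aux

infixl 6 _+_
infixl 7 _*_

_+_ : ℝ → ℝ → ℝ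
x + y = mkℝ (λ n → seq x n ℚ.+ seq y n) (+-cauchy {seq x} {seq y} (cauchy x) (cauchy y))

_*_ : ℝ → ℝ → ℝ
x * y = mkℝ (λ n → seq x n ℚ.* seq y n) (*-cauchy {seq x} {seq y} (cauchy x) (cauchy y))

module √-Aux where
  open ℚₚ
  open +-*-Solver using (solve; _:+_; _:*_; :-_; _:=_; con; _:-_)

  sqrt-step : ∀ {x y h} m n → 0ℚ ℚ.< h → frac 1 n ℚ.≤ h → x ℚ.≤ y ℚ.+ h ℚ.* h →
              sqrtℚ m x ℚ.≤ sqrtℚ n y ℚ.+ (h ℚ.+ h)
  sqrt-step {x} {y} {h} m n 0<h u≤h x≤y = ≮⇒≥ λ lt →
    <-irrefl refl (<-≤-trans (≤-<-trans (lo lt) mid) hi)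
    where
    s = sqrtℚ m x
    t = sqrtℚ n y
    u = frac 1 n
    0≤h = <⇒≤ 0<h
    0≤t = sqrtℚ-nonneg n y
    0≤hh = *-nn 0≤h 0≤h
    0≤t+2h = +-nn 0≤t (+-nn 0≤h 0≤h)
    x⁺≤ : x ℚ.⊔ 0ℚ ℚ.≤ y ℚ.⊔ 0ℚ ℚ.+ h ℚ.* h
    x⁺≤ = ⊔-lub (≤-trans x≤y (+-monoˡ-≤ (h ℚ.* h) (p≤p⊔q y 0ℚ)))
                (+-nn (p≤q⊔p y 0ℚ) 0≤hh)
    lo : t ℚ.+ (h ℚ.+ h) ℚ.< s →
         (t ℚ.+ (h ℚ.+ h)) ℚ.* (t ℚ.+ (h ℚ.+ h)) ℚ.≤ y ℚ.⊔ 0ℚ ℚ.+ h ℚ.* h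
    lo lt = ≤-trans (*-mono 0≤t+2h (sqrtℚ-nonneg m x) (<⇒≤ lt) (<⇒≤ lt))
            (≤-trans (sqrtℚ-lower m x) x⁺≤)
    mid : y ℚ.⊔ 0ℚ ℚ.+ h ℚ.* h ℚ.< (t ℚ.+ u) ℚ.* (t ℚ.+ u) ℚ.+ h ℚ.* h
    mid = +-monoˡ-< (h ℚ.* h) (sqrtℚ-upper n y)
    hi : (t ℚ.+ u) ℚ.* (t ℚ.+ u) ℚ.+ h ℚ.* h ℚ.≤ (t ℚ.+ (h ℚ.+ h)) ℚ.* (t ℚ.+ (h ℚ.+ h))
    hi = ≤-trans (+-monoˡ-≤ (h ℚ.* h)
           (*-mono (+-nn 0≤t (0≤frac 1 n)) (+-nn 0≤t 0≤h) (+-monoʳ-≤ t u≤h) (+-monoʳ-≤ t u≤h)))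
         (≤-trans (p≤p+q _ (+-nn (*-nn (+-nn 0≤h 0≤h) 0≤t) (+-nn 0≤hh 0≤hh)))
         (≤-reflexive (solve 2 (λ t h →
            ((t :+ h) :* (t :+ h) :+ h :* h) :+ ((h :+ h) :* t :+ (h :* h :+ h :* h))
            := (t :+ (h :+ h)) :* (t :+ (h :+ h))) refl t h)))

  sqrt-cauchy : ∀ {s} → IsCauchy s → IsCauchy (λ n → sqrtℚ n (s n))
  sqrt-cauchy {s} cs ε 0<ε = K ℕ.⊔ L , λ m n lm ln →
    ≤⇒∣-∣ (step m n lm ln) (step n m ln lm)
    where
    h = ½ ℚ.* ε
    0<h = *-pp 0<½ 0<ε
    K = proj₁ (cs (h ℚ.* h) (*-pp 0<h 0<h))
    L = proj₁ (archimedean h 0<h)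
    step : ∀ m n → K ℕ.⊔ L ℕ.≤ m → K ℕ.⊔ L ℕ.≤ n → sqrtℚ m (s m) ℚ.≤ sqrtℚ n (s n) ℚ.+ ε
    step m n lm ln = subst (λ e → sqrtℚ m (s m) ℚ.≤ sqrtℚ n (s n) ℚ.+ e) (½ε+½ε ε)
      (sqrt-step m n 0<h (proj₂ (archimedean h 0<h) n (ℕₚ.m⊔n≤o⇒n≤o K L ln))
        (∣-∣⇒≤ (proj₂ (cs (h ℚ.* h) (*-pp 0<h 0<h)) m n
          (ℕₚ.m⊔n≤o⇒m≤o K L lm) (ℕₚ.m⊔n≤o⇒m≤o K L ln))))

open √-Aux

infix 8 √_

-- Total: √ x is the square root of max(x,0).
√_ : ℝ → ℝ
√ x = mkℝ (λ n → sqrtℚ n (seq x n)) (sqrt-cauchy {seq x} (cauchy x))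

√-nonneg : ∀ x → 0ℝ ≤ √ x
√-nonneg x ε 0<ε = 0 , λ n _ → +-nn (sqrtℚ-nonneg n (seq x n)) (ℚₚ.<⇒≤ 0<ε)

√-square : ∀ x → 0ℝ ≤ x → √ x * √ x ≃ x
√-square x 0≤x = lower , upper
  where
  open ℚₚ

  lower : √ x * √ x ≤ x
  lower ε 0<ε with 0≤x ε 0<ε
  ... | N , h = N , λ n N≤n → ≤-trans (sqrtℚ-lower n (seq x n))
    (⊔-lub (p≤p+q (seq x n) (<⇒≤ 0<ε)) (h n N≤n))

  upper : x ≤ √ x * √ x
  upper ε 0<ε =
    let N , B , 0<B , b = bounded {seq (√ x)} (cauchy (√ x))
        C = B ℚ.+ B ℚ.+ 1ℚ
        δ , 0<δ , Cδ = div ε C 0<ε (<-≤-trans 0<1 (q≤p+q 1ℚ (+-nn (<⇒≤ 0<B) (<⇒≤ 0<B))))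
        K , f = archimedean δ 0<δ
        L , g = archimedean 1ℚ 0<1
    in N ℕ.⊔ (K ℕ.⊔ L) , λ n ln →
      let ln′ = ℕₚ.m⊔n≤o⇒n≤o N (K ℕ.⊔ L) ln
          s = sqrtℚ n (seq x n)
          u = frac 1 n
      in ≤-trans (p≤p⊔q (seq x n) 0ℚ)
        (≤-trans (<⇒≤ (sqrtℚ-upper n (seq x n)))
        (subst (λ e → (s ℚ.+ u) ℚ.* (s ℚ.+ u) ℚ.≤ s ℚ.* s ℚ.+ e) Cδ
          (square-+-≤ s u B δ (sqrtℚ-nonneg n (seq x n)) (0≤frac 1 n) (<⇒≤ 0<δ)
            (≤-trans (p≤∣p∣ s) (b n (ℕₚ.m⊔n≤o⇒m≤o N (K ℕ.⊔ L) ln)))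
            (f n (ℕₚ.m⊔n≤o⇒m≤o K L ln′)) (g n (ℕₚ.m⊔n≤o⇒n≤o K L ln′)))))

∑ : ∀ {n} → Subset n → (Fin n → ℝ) → ℝ
∑ []            f = 0ℝ
∑ (inside  ∷ S) f = f zero + ∑ S (f ∘ suc)
∑ (outside ∷ S) f = ∑ S (f ∘ suc)

record SMBP : Set where
  field
    N   : ℕ
    μ b : Fin N → ℝ
    V D : ℝ
    μ≥0 : ∀ j → 0ℝ ≤ μ j
    b≥0 : ∀ j → 0ℝ ≤ b j
    V>0 : 0ℝ < V
    D≥0 : 0ℝ ≤ D

  Feasible : Subset N → Set
  Feasible S = ∑ S μ + D * √ (∑ S b) ≤ V

  field
    singleton-feasible : ∀ j → Feasible ⁅ j ⁆

module _ (I : SMBP) where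
  open SMBP I

  jobsOn : ∀ {k} → (Fin N → Fin k) → Fin k → Subset N
  jobsOn a i = Vec.tabulate (λ j → does (a j ≟ᶠ i))

  -- Some of the k machines may stay empty, which does not affect the minimum.
  Servable : ℕ → Set
  Servable k = Σ (Fin N → Fin k) λ a → ∀ i → Feasible (jobsOn a i)

  IsOPT : ℕ → Set
  IsOPT k = Servable k × (∀ k′ → Servable k′ → k ℕ.≤ k′)

  -- The purchased machines, each given by the set of jobs assigned to it.
  Machines : ℕ → Set
  Machines m = Vec (Subset N) m

  data LazyStep (j : Fin N) {m} (M : Machines m) : ∀ {m′} → Machines m′ → Set where
    assign   : ∀ i → Feasible (Vec.lookup M i ∪ ⁅ j ⁆) →
               LazyStep j M (M [ i ]≔ (Vec.lookup M i ∪ ⁅ j ⁆))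
    purchase : (∀ i → ¬ Feasible (Vec.lookup M i ∪ ⁅ j ⁆)) →
               LazyStep j M (⁅ j ⁆ ∷ M)

  data LazySteps {m} (M : Machines m) : List (Fin N) → ∀ {m′} → Machines m′ → Set where
    []  : LazySteps M [] M
    _∷_ : ∀ {j js m′ m″} {M′ : Machines m′} {M″ : Machines m″} →
          LazyStep j M M′ → LazySteps M′ js M″ → LazySteps M (j ∷ js) M″

  -- A lazy algorithm may choose any machine that accommodates the new job
  -- (by any rule), so its possible outcomes are exactly the final states of
  -- such runs.  The job arriving at time t is π ⟨$⟩ʳ t.
  LazyRun : Permutation′ N → ∀ {m} → Machines m → Set
  LazyRun π M = LazySteps [] (tabulate (π ⟨$⟩ʳ_)) M

{-# OPTIONS --safe #-}

-- Give job j the weight 4(V μⱼ + D² bⱼ), which is additive over sets of jobs.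
-- A feasible set has D√(∑b) ≤ V, hence D² ∑b ≤ V D√(∑b) and total weight at
-- most 4V².  For an infeasible set, V < ∑μ + s with s = D√(∑b), and
-- 4 V s ≤ V² + 4 s² shows that its weight is at least 3V².  In a lazy run the
-- first job of the later of two machines did not fit on the earlier one, so
-- any two machines together weigh at least 3V².  With m ≥ 2 machines, the
-- total weight is therefore at least (3/2) m V², while it is at most 4V² OPT.
-- Strict inequalities are never needed: a negated ≤ between reals is only
-- used as ≥, which holds constructively.

module Submission where

import Data.Nat.Base as ℕ
import Data.Nat.Properties as ℕₚ
open import Level using (0ℓ)
open import Algebra.Bundles using (CommutativeMonoid)
open import Data.Bool.Base using (Bool; true; false; if_then_else_)
open import Data.Fin.Base using (Fin; zero; suc; fromℕ<)
open import Data.Fin.Patterns using (0F; 1F; 2F)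
open import Data.Fin.Permutation using (Permutation′; _⟨$⟩ʳ_)
open import Data.Fin.Properties using (suc-injective) renaming (_≟_ to _≟ᶠ_)
open import Data.Fin.Subset using (Subset; inside; outside; ⁅_⁆; ⊥; _∪_)
open import Data.Fin.Subset.Properties using (∪-identityʳ)
open import Data.List.Base using (List; []; _∷_; tabulate; foldr; length)
open import Data.List.Properties using (length-tabulate)
open import Data.Nat.Base using (ℕ; zero; suc)
open import Data.Product.Base using (∃; _×_; _,_; proj₁; proj₂)
open import Data.Rational.Base as ℚ using (ℚ; 0ℚ; ½)
import Data.Rational.Properties as ℚₚ
open import Data.Rational.Solver using (module +-*-Solver)
open import Data.Vec.Base as Vec using ([]; _∷_; lookup; _[_]≔_)
open import Data.Vec.Properties using (lookup∘update; lookup∘update′)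
open import Data.Sum.Base using ([_,_]′)
open import Function.Base using (_∘_)
open import Relation.Binary.Bundles using (Poset)
open import Relation.Binary.PropositionalEquality as ≡ using (_≡_; _≢_; refl)
open import Relation.Nullary.Decidable using (Dec; yes; no; does)
open import Relation.Nullary.Negation using (¬_; contradiction)

-- Order and arithmetic of Cauchy reals.

module Real where

  open import Defs
  open ℚ-Aux
  open Cauchy-Aux
  open +-*-Solver using (solve; _:+_; _:*_; _:-_; _:=_; con)

  infix 4 _≼_ _≈_

  -- A record rather than the function type _≤_, so that the endpoints of an
  -- inequality can be inferred.
  record _≼_ (x y : ℝ) : Set where
    constructor ⟨_⟩
    field holds : x ≤ y

  _≈_ : ℝ → ℝ → Set
  x ≈ y = x ≼ y × y ≼ x

  pointwise-≼ : ∀ {x y} → (∀ n → seq x n ℚ.≤ seq y n) → x ≼ y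
  pointwise-≼ {x} {y} h = ⟨ (λ ε 0<ε → 0 , λ n _ → ℚₚ.≤-trans (h n) (p≤p+q (seq y n) (ℚₚ.<⇒≤ 0<ε))) ⟩

  pointwise-≈ : ∀ {x y} → (∀ n → seq x n ≡ seq y n) → x ≈ y
  pointwise-≈ h = pointwise-≼ (ℚₚ.≤-reflexive ∘ h) , pointwise-≼ (ℚₚ.≤-reflexive ∘ ≡.sym ∘ h)

  -- Unfolded, the operations on ℝ carry Cauchy proofs, whose comparison during
  -- conversion checking is prohibitively expensive.
  infixl 6 _⊕_
  infixl 7 _⊗_

  opaque
    _⊕_ : ℝ → ℝ → ℝ
    _⊕_ = _+_

    _⊗_ : ℝ → ℝ → ℝ
    _⊗_ = _*_

    sqrt : ℝ → ℝ
    sqrt = √_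

    seq-⊗ : ∀ x y n → seq (x ⊗ y) n ≡ seq x n ℚ.* seq y n
    seq-⊗ x y n = refl

    +≡⊕ : ∀ {x y} → x + y ≡ x ⊕ y
    +≡⊕ = refl

    -- Translates the left side of `Feasible` into the opaque operations. It is proved here, where
    -- these still unfold, so that both sequences agree by computation.
    capacity-use : ∀ x y z → x + y * √ z ≈ x ⊕ y ⊗ sqrt z
    capacity-use x y z = pointwise-≈ {x + y * √ z} {x ⊕ y ⊗ sqrt z} λ _ → refl

    sqrt-nonneg : ∀ x → 0ℝ ≼ sqrt x
    sqrt-nonneg x = ⟨ √-nonneg x ⟩

    sqrt-square : ∀ {x} → 0ℝ ≼ x → sqrt x ⊗ sqrt x ≈ x
    sqrt-square {x} ⟨ 0≤x ⟩ =
      ⟨ (λ ε → proj₁ (√-square x 0≤x) ε) ⟩ , ⟨ (λ ε → proj₂ (√-square x 0≤x) ε) ⟩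

  ≤-trans-½ : ∀ {p q r ε} → p ℚ.≤ q ℚ.+ ½ ℚ.* ε → q ℚ.≤ r ℚ.+ ½ ℚ.* ε → p ℚ.≤ r ℚ.+ ε
  ≤-trans-½ {p} {q} {r} {ε} h k = ℚₚ.≤-trans h (ℚₚ.≤-trans (ℚₚ.+-monoˡ-≤ (½ ℚ.* ε) k)
    (ℚₚ.≤-reflexive (≡.trans (ℚₚ.+-assoc r _ _) (≡.cong (r ℚ.+_) (½ε+½ε ε)))))

  ≼-refl : ∀ {x} → x ≼ x
  ≼-refl = pointwise-≼ λ _ → ℚₚ.≤-refl

  ≼-trans : ∀ {x y z} → x ≼ y → y ≼ z → x ≼ z
  ≼-trans {z = z} ⟨ h ⟩ ⟨ k ⟩ = ⟨ (λ ε 0<ε →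
    let M , f = h (½ ℚ.* ε) (*-pp 0<½ 0<ε)
        N , g = k (½ ℚ.* ε) (*-pp 0<½ 0<ε)
    in M ℕ.⊔ N , λ n le → ≤-trans-½ {r = seq z n} {ε} (f n (ℕₚ.m⊔n≤o⇒m≤o M N le)) (g n (ℕₚ.m⊔n≤o⇒n≤o M N le))) ⟩

  ≼-poset : Poset 0ℓ 0ℓ 0ℓ
  ≼-poset = record
    { _≈_ = _≈_
    ; _≤_ = _≼_
    ; isPartialOrder = record
      { isPreorder = record
        { isEquivalence = record
          { refl = ≼-refl , ≼-refl
          ; sym = λ (h , k) → k , h
          ; trans = λ (h , k) (h′ , k′) → ≼-trans h h′ , ≼-trans k′ k }
        ; reflexive = proj₁
        ; trans = ≼-trans }
      ; antisym = _,_ } }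

  opaque
    unfolding _⊕_ _⊗_

    ⊕-mono-≼ : ∀ {x y u v} → x ≼ y → u ≼ v → x ⊕ u ≼ y ⊕ v
    ⊕-mono-≼ {x} {y} {u} {v} ⟨ h ⟩ ⟨ k ⟩ = ⟨ (λ ε 0<ε →
      let M , f = h (½ ℚ.* ε) (*-pp 0<½ 0<ε)
          N , g = k (½ ℚ.* ε) (*-pp 0<½ 0<ε)
      in M ℕ.⊔ N , λ n le → ℚₚ.≤-trans
        (ℚₚ.+-mono-≤ (f n (ℕₚ.m⊔n≤o⇒m≤o M N le)) (g n (ℕₚ.m⊔n≤o⇒n≤o M N le)))
        (ℚₚ.≤-reflexive (≡.trans
          (solve 3 (λ y v e → (y :+ e) :+ (v :+ e) := (y :+ v) :+ (e :+ e)) refl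
            (seq y n) (seq v n) (½ ℚ.* ε))
          (≡.cong (seq y n ℚ.+ seq v n ℚ.+_) (½ε+½ε ε))))) ⟩

    ⊕-cancelʳ-≼ : ∀ {x y} z → x ⊕ z ≼ y ⊕ z → x ≼ y
    ⊕-cancelʳ-≼ {x} {y} z ⟨ h ⟩ = ⟨ (λ ε 0<ε →
      let N , f = h ε 0<ε in N , λ n le → ≡.subst₂ ℚ._≤_
        (solve 2 (λ x z → (x :+ z) :- z := x) refl (seq x n) (seq z n))
        (solve 3 (λ y z e → ((y :+ z) :+ e) :- z := y :+ e) refl (seq y n) (seq z n) ε)
        (ℚₚ.+-monoˡ-≤ (ℚ.- seq z n) (f n le))) ⟩

  opaque
    unfolding _⊕_

    ⊕-assoc : ∀ x y z → (x ⊕ y) ⊕ z ≈ x ⊕ (y ⊕ z)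
    ⊕-assoc x y z = pointwise-≈ {(x ⊕ y) ⊕ z} {x ⊕ (y ⊕ z)} λ n →
      ℚₚ.+-assoc (seq x n) (seq y n) (seq z n)

    ⊕-identityˡ : ∀ x → 0ℝ ⊕ x ≈ x
    ⊕-identityˡ x = pointwise-≈ {0ℝ ⊕ x} {x} λ n → ℚₚ.+-identityˡ (seq x n)

    ⊕-identityʳ : ∀ x → x ⊕ 0ℝ ≈ x
    ⊕-identityʳ x = pointwise-≈ {x ⊕ 0ℝ} {x} λ n → ℚₚ.+-identityʳ (seq x n)

    ⊕-comm : ∀ x y → x ⊕ y ≈ y ⊕ x
    ⊕-comm x y = pointwise-≈ {x ⊕ y} {y ⊕ x} λ n → ℚₚ.+-comm (seq x n) (seq y n)

  -- This bundle makes natural multiples, finite sums and the commutative monoid solver available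
  -- for reals up to `≈`.
  ℝ-commutativeMonoid : CommutativeMonoid 0ℓ 0ℓ
  ℝ-commutativeMonoid = record
    { _≈_ = _≈_
    ; _∙_ = _⊕_
    ; ε = 0ℝ
    ; isCommutativeMonoid = record
      { isMonoid = record
        { isSemigroup = record
          { isMagma = record
            { isEquivalence = Poset.isEquivalence ≼-poset
            ; ∙-cong = λ (h , k) (h′ , k′) → ⊕-mono-≼ h h′ , ⊕-mono-≼ k k′ }
          ; assoc = ⊕-assoc }
        ; identity = ⊕-identityˡ , ⊕-identityʳ }
      ; comm = ⊕-comm } }

  -- (z + δ)(y + γ - x) ≥ 0, and δ and γ can be chosen so that all terms other
  -- than z y - z x contribute at most ε.
  *-monoˡ-≤-seq : ∀ {z x y} → IsCauchy z → IsCauchy x → IsCauchy y →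
    (∀ ε → 0ℚ ℚ.< ε → ∃ λ N → ∀ n → N ℕ.≤ n → 0ℚ ℚ.≤ z n ℚ.+ ε) →
    (∀ ε → 0ℚ ℚ.< ε → ∃ λ N → ∀ n → N ℕ.≤ n → x n ℚ.≤ y n ℚ.+ ε) →
    ∀ ε → 0ℚ ℚ.< ε → ∃ λ N → ∀ n → N ℕ.≤ n → z n ℚ.* x n ℚ.≤ z n ℚ.* y n ℚ.+ ε
  *-monoˡ-≤-seq {z} {x} {y} cz cx cy 0≤z x≤y ε 0<ε =
    from-bounds (bounded {x} cx) (bounded {y} cy) (bounded {z} cz)
    where
    estimate : ∀ z x y {δ γ X Y Z ε} → 0ℚ ℚ.≤ z ℚ.+ δ → x ℚ.≤ y ℚ.+ γ → 0ℚ ℚ.≤ δ → 0ℚ ℚ.≤ γ →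
      ℚ.∣ x ∣ ℚ.≤ X → ℚ.∣ y ∣ ℚ.≤ Y → ℚ.∣ z ∣ ℚ.≤ Z → (Z ℚ.+ δ) ℚ.* γ ℚ.+ (Y ℚ.+ X) ℚ.* δ ≡ ε →
      z ℚ.* x ℚ.≤ z ℚ.* y ℚ.+ ε
    estimate z x y {δ} {γ} {X} {Y} {Z} 0≤z+δ x≤y+γ 0≤δ 0≤γ ∣x∣≤X ∣y∣≤Y ∣z∣≤Z refl =
      ℚₚ.≤-trans (p≤p+q (z ℚ.* x) (*-nn 0≤z+δ 0≤y+γ-x))
      (ℚₚ.≤-trans (ℚₚ.≤-reflexive (solve 5 (λ z x y d c →
          z :* x :+ (z :+ d) :* ((y :+ c) :- x) := z :* y :+ ((z :+ d) :* c :+ (y :- x) :* d))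
          refl z x y δ γ))
      (ℚₚ.+-monoʳ-≤ (z ℚ.* y) (ℚₚ.+-mono-≤
        (ℚₚ.*-monoʳ-≤-nonNeg γ {{ℚ.nonNegative 0≤γ}}
          (ℚₚ.+-monoˡ-≤ δ (ℚₚ.≤-trans (p≤∣p∣ z) ∣z∣≤Z)))
        (ℚₚ.*-monoʳ-≤-nonNeg δ {{ℚ.nonNegative 0≤δ}}
          (ℚₚ.+-mono-≤ (ℚₚ.≤-trans (p≤∣p∣ y) ∣y∣≤Y)
            (ℚₚ.≤-trans (p≤∣p∣ (ℚ.- x)) (ℚₚ.≤-trans (ℚₚ.≤-reflexive (ℚₚ.∣-p∣≡∣p∣ x)) ∣x∣≤X)))))))
      where
      0≤y+γ-x : 0ℚ ℚ.≤ (y ℚ.+ γ) ℚ.- x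
      0≤y+γ-x = ≡.subst (ℚ._≤ (y ℚ.+ γ) ℚ.- x) (ℚₚ.+-inverseʳ x) (ℚₚ.+-monoˡ-≤ (ℚ.- x) x≤y+γ)

    from-bounds :
      (∃ λ I → ∃ λ X → 0ℚ ℚ.< X × (∀ n → I ℕ.≤ n → ℚ.∣ x n ∣ ℚ.≤ X)) →
      (∃ λ J → ∃ λ Y → 0ℚ ℚ.< Y × (∀ n → J ℕ.≤ n → ℚ.∣ y n ∣ ℚ.≤ Y)) →
      (∃ λ K → ∃ λ Z → 0ℚ ℚ.< Z × (∀ n → K ℕ.≤ n → ℚ.∣ z n ∣ ℚ.≤ Z)) →
      ∃ λ N → ∀ n → N ℕ.≤ n → z n ℚ.* x n ℚ.≤ z n ℚ.* y n ℚ.+ ε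
    from-bounds (I , X , 0<X , bx) (J , Y , 0<Y , by) (K , Z , 0<Z , bz) =
      choose-δ (div (½ ℚ.* ε) (Y ℚ.+ X) (*-pp {½} {ε} 0<½ 0<ε) (ℚₚ.+-mono-< 0<Y 0<X))
      where
      choose-N : ∀ {δ γ} → 0ℚ ℚ.≤ δ → 0ℚ ℚ.≤ γ → (Z ℚ.+ δ) ℚ.* γ ℚ.+ (Y ℚ.+ X) ℚ.* δ ≡ ε →
        (∃ λ L → ∀ n → L ℕ.≤ n → 0ℚ ℚ.≤ z n ℚ.+ δ) →
        (∃ λ M → ∀ n → M ℕ.≤ n → x n ℚ.≤ y n ℚ.+ γ) →
        ∃ λ N → ∀ n → N ℕ.≤ n → z n ℚ.* x n ℚ.≤ z n ℚ.* y n ℚ.+ ε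
      choose-N 0≤δ 0≤γ eq (L , f) (M , g) = I ℕ.⊔ J ℕ.⊔ K ℕ.⊔ (L ℕ.⊔ M) , λ n le →
        let leˡ = ℕₚ.m⊔n≤o⇒m≤o (I ℕ.⊔ J ℕ.⊔ K) (L ℕ.⊔ M) le
            leʳ = ℕₚ.m⊔n≤o⇒n≤o (I ℕ.⊔ J ℕ.⊔ K) (L ℕ.⊔ M) le
            leˡˡ = ℕₚ.m⊔n≤o⇒m≤o (I ℕ.⊔ J) K leˡ
        in estimate (z n) (x n) (y n)
            (f n (ℕₚ.m⊔n≤o⇒m≤o L M leʳ)) (g n (ℕₚ.m⊔n≤o⇒n≤o L M leʳ)) 0≤δ 0≤γ
            (bx n (ℕₚ.m⊔n≤o⇒m≤o I J leˡˡ)) (by n (ℕₚ.m⊔n≤o⇒n≤o I J leˡˡ))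
            (bz n (ℕₚ.m⊔n≤o⇒n≤o (I ℕ.⊔ J) K leˡ)) eq

      choose-γ : ∀ {δ} → 0ℚ ℚ.< δ → (Y ℚ.+ X) ℚ.* δ ≡ ½ ℚ.* ε →
        (∃ λ γ → 0ℚ ℚ.< γ × (Z ℚ.+ δ) ℚ.* γ ≡ ½ ℚ.* ε) →
        ∃ λ N → ∀ n → N ℕ.≤ n → z n ℚ.* x n ℚ.≤ z n ℚ.* y n ℚ.+ ε
      choose-γ {δ} 0<δ δ-eq (γ , 0<γ , γ-eq) = choose-N (ℚₚ.<⇒≤ 0<δ) (ℚₚ.<⇒≤ 0<γ)
        (≡.trans (≡.cong₂ ℚ._+_ γ-eq δ-eq) (½ε+½ε ε)) (0≤z δ 0<δ) (x≤y γ 0<γ)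

      choose-δ : (∃ λ δ → 0ℚ ℚ.< δ × (Y ℚ.+ X) ℚ.* δ ≡ ½ ℚ.* ε) →
        ∃ λ N → ∀ n → N ℕ.≤ n → z n ℚ.* x n ℚ.≤ z n ℚ.* y n ℚ.+ ε
      choose-δ (δ , 0<δ , δ-eq) = choose-γ 0<δ δ-eq
        (div (½ ℚ.* ε) (Z ℚ.+ δ) (*-pp {½} {ε} 0<½ 0<ε) (ℚₚ.+-mono-< 0<Z 0<δ))

  opaque
    unfolding _⊕_ _⊗_

    ⊗-monoˡ-≼ : ∀ {z x y} → 0ℝ ≼ z → x ≼ y → z ⊗ x ≼ z ⊗ y
    ⊗-monoˡ-≼ {z} {x} {y} ⟨ 0≤z ⟩ ⟨ x≤y ⟩ =
      ⟨ *-monoˡ-≤-seq {seq z} {seq x} {seq y} (cauchy z) (cauchy x) (cauchy y) 0≤z x≤y ⟩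

    ⊗-nonneg : ∀ {x y} → 0ℝ ≼ x → 0ℝ ≼ y → 0ℝ ≼ x ⊗ y
    ⊗-nonneg {x} {y} 0≼x 0≼y = ≼-trans {0ℝ} {x ⊗ 0ℝ} {x ⊗ y}
      (pointwise-≼ λ n → ℚₚ.≤-reflexive (≡.sym (ℚₚ.*-zeroʳ (seq x n)))) (⊗-monoˡ-≼ {x} {0ℝ} {y} 0≼x 0≼y)

  -- Comparing rationals is decidable, so it suffices to compare at one index `L` from which on both
  -- sequences vary by at most `ε/4`. If `y` exceeds `x` by at most `ε/2` there, the tolerance `ε`
  -- holds from `L` on. A larger excess would put `x` below `y` from `L` on, against the hypothesis.
  ≰⇒≽ : ∀ {x y} → ¬ (x ≤ y) → y ≼ x
  ≰⇒≽ {x} {y} x≰y = ⟨ (λ ε 0<ε → let 0<k = *-pp {½} {½ ℚ.* ε} 0<½ (*-pp {½} {ε} 0<½ 0<ε) in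
    decide ε (cauchy x (½ ℚ.* (½ ℚ.* ε)) 0<k) (cauchy y (½ ℚ.* (½ ℚ.* ε)) 0<k)) ⟩
    where
    CauchyAt : (ℕ → ℚ) → ℚ → Set
    CauchyAt s k = ∃ λ N → ∀ m n → N ℕ.≤ m → N ℕ.≤ n → ℚ.∣ s m ℚ.- s n ∣ ℚ.≤ k

    decide : ∀ ε → CauchyAt (seq x) (½ ℚ.* (½ ℚ.* ε)) → CauchyAt (seq y) (½ ℚ.* (½ ℚ.* ε)) →
             ∃ λ L → ∀ m → L ℕ.≤ m → seq y m ℚ.≤ seq x m ℚ.+ ε
    decide ε (M , f) (N , g) =
      case (seq y L ℚₚ.≤? seq x L ℚ.+ ½ ℚ.* ε)
      where
      L = M ℕ.⊔ N
      k = ½ ℚ.* (½ ℚ.* ε)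

      case : Dec (seq y L ℚ.≤ seq x L ℚ.+ ½ ℚ.* ε) →
             ∃ λ L → ∀ m → L ℕ.≤ m → seq y m ℚ.≤ seq x m ℚ.+ ε
      -- The tolerance adds up to `ε/4 + ε/2 + ε/4`: the variation of `y`, the comparison at `L`,
      -- the variation of `x`.
      case (yes y≤x+h) = L , λ m L≤m →
        ℚₚ.≤-trans (∣-∣⇒≤ {seq y m} {seq y L} (g m L (ℕₚ.m⊔n≤o⇒n≤o M N L≤m) (ℕₚ.m≤n⊔m M N)))
        (ℚₚ.≤-trans (ℚₚ.+-monoˡ-≤ k y≤x+h)
        (ℚₚ.≤-trans (ℚₚ.+-monoˡ-≤ k (ℚₚ.+-monoˡ-≤ (½ ℚ.* ε)
          (∣-∣⇒≤ {seq x L} {seq x m} (f L m (ℕₚ.m≤m⊔n M N) (ℕₚ.m⊔n≤o⇒m≤o M N L≤m)))))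
        (ℚₚ.≤-reflexive (solve 2 (λ x e →
          ((x :+ con ½ :* (con ½ :* e)) :+ con ½ :* e) :+ con ½ :* (con ½ :* e) := x :+ e)
          refl (seq x m) ε))))
      case (no y≰x+h) = contradiction x≤y x≰y
        where
        x≤y : x ≤ y
        -- The excess over `ε/2` at `L` pays for both variations of `ε/4`, so the inequality holds
        -- without slack and the same `L` serves every `δ`.
        x≤y δ 0<δ = L , λ m L≤m →
          ℚₚ.≤-trans (∣-∣⇒≤ {seq x m} {seq x L} (f m L (ℕₚ.m⊔n≤o⇒m≤o M N L≤m) (ℕₚ.m≤m⊔n M N)))
          (ℚₚ.≤-trans (ℚₚ.≤-reflexive (solve 2 (λ x e →
            x :+ con ½ :* (con ½ :* e) := (x :+ con ½ :* e) :- con ½ :* (con ½ :* e))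
            refl (seq x L) ε))
          (ℚₚ.≤-trans (ℚₚ.+-monoˡ-≤ (ℚ.- k) (ℚₚ.<⇒≤ (ℚₚ.≰⇒> y≰x+h)))
          (ℚₚ.≤-trans (≤⇒-≤ (≡.subst (seq y L ℚ.≤_) (ℚₚ.+-comm (seq y m) k)
            (∣-∣⇒≤ {seq y L} {seq y m} (g L m (ℕₚ.m≤n⊔m M N) (ℕₚ.m⊔n≤o⇒n≤o M N L≤m)))))
          (p≤p+q (seq y m) (ℚₚ.<⇒≤ 0<δ)))))

-- The weight of a set and its bounds in the feasible and infeasible cases.

module Weight where

  open import Defs using (ℝ; seq; 0ℝ; module ℚ-Aux)
  open Real
  open ℚ-Aux using (*-nn; p≤p+q)
  open +-*-Solver using (solve; _:+_; _:*_; _:-_; _:=_; con)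
  -- Numerical coefficients are natural multiples `k · x` in the additive monoid; this avoids
  -- embedding numbers into `ℝ`.
  open import Algebra.Definitions.RawMonoid (CommutativeMonoid.rawMonoid ℝ-commutativeMonoid) public
    using () renaming (_×_ to infixr 8 _·_)
  open CommutativeMonoid ℝ-commutativeMonoid using (∙-cong; ∙-congˡ; commutativeSemigroup)
  open import Algebra.Properties.CommutativeMonoid.Mult ℝ-commutativeMonoid public
    using (×-homo-+; ×-congʳ; ×-assocˡ; ×-idem; ×-distrib-+)
  open import Algebra.Properties.CommutativeSemigroup commutativeSemigroup using (interchange)
  open import Relation.Binary.Reasoning.PartialOrder ≼-poset

  ·-monoʳ-≼ : ∀ k {x y} → x ≼ y → k · x ≼ k · y
  ·-monoʳ-≼ zero    x≼y = ≼-refl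
  ·-monoʳ-≼ (suc k) x≼y = ⊕-mono-≼ x≼y (·-monoʳ-≼ k x≼y)

  square-nonnegℚ : ∀ p → 0ℚ ℚ.≤ p ℚ.* p
  square-nonnegℚ p = [ (λ 0≤p → *-nn 0≤p 0≤p) , negative ]′ (ℚₚ.≤-total 0ℚ p)
    where
    negative : p ℚ.≤ 0ℚ → 0ℚ ℚ.≤ p ℚ.* p
    negative p≤0 = ≡.subst (0ℚ ℚ.≤_) (solve 1 (λ p → (con 0ℚ :- p) :* (con 0ℚ :- p) := p :* p) refl p)
      (*-nn 0≤-p 0≤-p)
      where
      0≤-p : 0ℚ ℚ.≤ 0ℚ ℚ.- p
      0≤-p = ≡.subst (ℚ._≤ 0ℚ ℚ.- p) (ℚₚ.+-inverseʳ p) (ℚₚ.+-monoˡ-≤ (ℚ.- p) p≤0)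

  opaque
    unfolding _⊕_ _⊗_

    square-nonneg : ∀ x → 0ℝ ≼ x ⊗ x
    square-nonneg x = pointwise-≼ {0ℝ} {x ⊗ x} λ n → square-nonnegℚ (seq x n)

    ⊗-distribˡ-⊕ : ∀ x y z → x ⊗ (y ⊕ z) ≈ x ⊗ y ⊕ x ⊗ z
    ⊗-distribˡ-⊕ x y z = pointwise-≈ {x ⊗ (y ⊕ z)} {x ⊗ y ⊕ x ⊗ z} λ n →
      ℚₚ.*-distribˡ-+ (seq x n) (seq y n) (seq z n)

    ⊗-comm : ∀ x y → x ⊗ y ≈ y ⊗ x
    ⊗-comm x y = pointwise-≈ {x ⊗ y} {y ⊗ x} λ n → ℚₚ.*-comm (seq x n) (seq y n)

    ⊗-zeroʳ : ∀ x → x ⊗ 0ℝ ≈ 0ℝ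
    ⊗-zeroʳ x = pointwise-≈ {x ⊗ 0ℝ} {0ℝ} λ n → ℚₚ.*-zeroʳ (seq x n)

    square-⊗ : ∀ x y → (x ⊗ x) ⊗ (y ⊗ y) ≈ (x ⊗ y) ⊗ (x ⊗ y)
    square-⊗ x y = pointwise-≈ {(x ⊗ x) ⊗ (y ⊗ y)} {(x ⊗ y) ⊗ (x ⊗ y)} λ n →
      solve 2 (λ x y → x :* x :* (y :* y) := (x :* y) :* (x :* y)) refl (seq x n) (seq y n)

    2xy≼x²+y² : ∀ x y → x ⊗ y ⊕ x ⊗ y ≼ x ⊗ x ⊕ y ⊗ y
    2xy≼x²+y² x y = pointwise-≼ {x ⊗ y ⊕ x ⊗ y} {x ⊗ x ⊕ y ⊗ y} λ n → 2xy≤x²+y² (seq x n) (seq y n)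
      where
      2xy≤x²+y² : ∀ x y → x ℚ.* y ℚ.+ x ℚ.* y ℚ.≤ x ℚ.* x ℚ.+ y ℚ.* y
      2xy≤x²+y² x y = ≡.subst (x ℚ.* y ℚ.+ x ℚ.* y ℚ.≤_)
        (solve 2 (λ x y → (x :* y :+ x :* y) :+ (x :- y) :* (x :- y) := x :* x :+ y :* y) refl x y)
        (p≤p+q (x ℚ.* y ℚ.+ x ℚ.* y) (square-nonnegℚ (x ℚ.- y)))

  ⊗-·-comm : ∀ k x y → x ⊗ (k · y) ≈ k · (x ⊗ y)
  ⊗-·-comm zero    x y = ⊗-zeroʳ x
  ⊗-·-comm (suc k) x y = begin-equality
    x ⊗ (y ⊕ k · y)      ≈⟨ ⊗-distribˡ-⊕ x y (k · y) ⟩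
    x ⊗ y ⊕ x ⊗ (k · y)  ≈⟨ ∙-congˡ (⊗-·-comm k x y) ⟩
    x ⊗ y ⊕ k · (x ⊗ y)  ∎

  -- This is `2xy≼x²+y²` at `x` and `2 · y`, that is, the nonnegativity of the square of `x - 2y`.
  4xy≼x²+4y² : ∀ x y → 4 · (x ⊗ y) ≼ x ⊗ x ⊕ 4 · (y ⊗ y)
  4xy≼x²+4y² x y = begin
    4 · (x ⊗ y)                            ≈⟨ ×-homo-+ (x ⊗ y) 2 2 ⟩
    2 · (x ⊗ y) ⊕ 2 · (x ⊗ y)              ≈⟨ ∙-cong (⊗-·-comm 2 x y) (⊗-·-comm 2 x y) ⟨
    x ⊗ (2 · y) ⊕ x ⊗ (2 · y)              ≤⟨ 2xy≼x²+y² x (2 · y) ⟩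
    x ⊗ x ⊕ (2 · y) ⊗ (2 · y)              ≈⟨ ∙-congˡ (⊗-·-comm 2 (2 · y) y) ⟩
    x ⊗ x ⊕ 2 · ((2 · y) ⊗ y)              ≈⟨ ∙-congˡ (×-congʳ 2 (⊗-comm (2 · y) y)) ⟩
    x ⊗ x ⊕ 2 · (y ⊗ (2 · y))              ≈⟨ ∙-congˡ (×-congʳ 2 (⊗-·-comm 2 y y)) ⟩
    x ⊗ x ⊕ 2 · 2 · (y ⊗ y)                ≈⟨ ∙-congˡ (×-assocˡ (y ⊗ y) 2 2) ⟩
    x ⊗ x ⊕ 4 · (y ⊗ y)                    ∎

  module _ (V D : ℝ) where

    opaque
      -- Taking two reals, it applies both to the parameters of one job and to the sums of the
      -- parameters over a set. Without the factor 4 the bound for infeasible sets would be three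
      -- quarters of `V ⊗ V`; with it both bounds are natural multiples of `V ⊗ V`.
      weight : ℝ → ℝ → ℝ
      weight x y = 4 · (V ⊗ x ⊕ D ⊗ D ⊗ y)

    opaque
      unfolding weight

      weight-0 : weight 0ℝ 0ℝ ≈ 0ℝ
      weight-0 = begin-equality
        4 · (V ⊗ 0ℝ ⊕ D ⊗ D ⊗ 0ℝ)  ≈⟨ ×-congʳ 4 (∙-cong (⊗-zeroʳ V) (⊗-zeroʳ (D ⊗ D))) ⟩
        4 · (0ℝ ⊕ 0ℝ)              ≈⟨ ×-congʳ 4 (⊕-identityˡ 0ℝ) ⟩
        4 · 0ℝ                     ≈⟨ ×-idem (⊕-identityˡ 0ℝ) 4 ⟩
        0ℝ                         ∎

      weight-⊕ : ∀ x x′ y y′ → weight (x ⊕ x′) (y ⊕ y′) ≈ weight x y ⊕ weight x′ y′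
      weight-⊕ x x′ y y′ = begin-equality
        4 · (V ⊗ (x ⊕ x′) ⊕ D ⊗ D ⊗ (y ⊕ y′))
          ≈⟨ ×-congʳ 4 (∙-cong (⊗-distribˡ-⊕ V x x′) (⊗-distribˡ-⊕ (D ⊗ D) y y′)) ⟩
        4 · ((V ⊗ x ⊕ V ⊗ x′) ⊕ (D ⊗ D ⊗ y ⊕ D ⊗ D ⊗ y′))
          ≈⟨ ×-congʳ 4 (interchange (V ⊗ x) (V ⊗ x′) (D ⊗ D ⊗ y) (D ⊗ D ⊗ y′)) ⟩
        4 · ((V ⊗ x ⊕ D ⊗ D ⊗ y) ⊕ (V ⊗ x′ ⊕ D ⊗ D ⊗ y′))
          ≈⟨ ×-distrib-+ (V ⊗ x ⊕ D ⊗ D ⊗ y) (V ⊗ x′ ⊕ D ⊗ D ⊗ y′) 4 ⟩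
        4 · (V ⊗ x ⊕ D ⊗ D ⊗ y) ⊕ 4 · (V ⊗ x′ ⊕ D ⊗ D ⊗ y′) ∎

    module _ (0≼V : 0ℝ ≼ V) (0≼D : 0ℝ ≼ D) {x y : ℝ} (0≼x : 0ℝ ≼ x) (0≼y : 0ℝ ≼ y) where
      private
        -- The square-root term of the capacity constraint. It is not additive over sets, but its
        -- square `D ⊗ D ⊗ y` is, which is why the weight contains that square.
        s : ℝ
        s = D ⊗ sqrt y

        0≼s : 0ℝ ≼ s
        0≼s = ⊗-nonneg 0≼D (sqrt-nonneg y)

        s²≼D²y : s ⊗ s ≼ D ⊗ D ⊗ y
        s²≼D²y = begin
          s ⊗ s                         ≈⟨ square-⊗ D (sqrt y) ⟨
          D ⊗ D ⊗ (sqrt y ⊗ sqrt y)   ≤⟨ ⊗-monoˡ-≼ (square-nonneg D) (proj₁ (sqrt-square 0≼y)) ⟩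
          D ⊗ D ⊗ y                   ∎

        D²y≼s² : D ⊗ D ⊗ y ≼ s ⊗ s
        D²y≼s² = begin
          D ⊗ D ⊗ y                   ≤⟨ ⊗-monoˡ-≼ (square-nonneg D) (proj₂ (sqrt-square 0≼y)) ⟩
          D ⊗ D ⊗ (sqrt y ⊗ sqrt y)   ≈⟨ square-⊗ D (sqrt y) ⟩
          s ⊗ s                         ∎

      opaque
        unfolding weight

        weight-nonneg : 0ℝ ≼ weight x y
        weight-nonneg = begin
          0ℝ                               ≈⟨ ×-idem (⊕-identityˡ 0ℝ) 4 ⟨
          4 · 0ℝ                           ≤⟨ ·-monoʳ-≼ 4 0≼sum ⟩
          4 · (V ⊗ x ⊕ D ⊗ D ⊗ y)        ∎
          where
          0≼sum : 0ℝ ≼ V ⊗ x ⊕ D ⊗ D ⊗ y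
          0≼sum = begin
            0ℝ                             ≈⟨ ⊕-identityˡ 0ℝ ⟨
            0ℝ ⊕ 0ℝ                        ≤⟨ ⊕-mono-≼ (⊗-nonneg 0≼V 0≼x) (⊗-nonneg (square-nonneg D) 0≼y) ⟩
            V ⊗ x ⊕ D ⊗ D ⊗ y            ∎

        -- s ≤ V gives D² y = s² ≤ V s.
        weight-feasible : x ⊕ s ≼ V → weight x y ≼ 4 · (V ⊗ V)
        weight-feasible x+s≼V = ·-monoʳ-≼ 4 (begin
          V ⊗ x ⊕ D ⊗ D ⊗ y   ≤⟨ ⊕-mono-≼ ≼-refl D²y≼s² ⟩
          V ⊗ x ⊕ s ⊗ s         ≤⟨ ⊕-mono-≼ ≼-refl (⊗-monoˡ-≼ 0≼s s≼V) ⟩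
          V ⊗ x ⊕ s ⊗ V         ≤⟨ ⊕-mono-≼ ≼-refl (proj₁ (⊗-comm s V)) ⟩
          V ⊗ x ⊕ V ⊗ s         ≈⟨ ⊗-distribˡ-⊕ V x s ⟨
          V ⊗ (x ⊕ s)           ≤⟨ ⊗-monoˡ-≼ 0≼V x+s≼V ⟩
          V ⊗ V                 ∎)
          where
          s≼V : s ≼ V
          s≼V = begin
            s       ≈⟨ ⊕-identityˡ s ⟨
            0ℝ ⊕ s  ≤⟨ ⊕-mono-≼ 0≼x ≼-refl ⟩
            x ⊕ s   ≤⟨ x+s≼V ⟩
            V       ∎

        -- 4 V² ≤ 4 V x + 4 V s and 4 V s ≤ V² + 4 s².
        weight-infeasible : V ≼ x ⊕ s → 3 · (V ⊗ V) ≼ weight x y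
        weight-infeasible V≼x+s = ⊕-cancelʳ-≼ (V ⊗ V) (begin
          3 · (V ⊗ V) ⊕ V ⊗ V                     ≈⟨ ⊕-comm _ _ ⟩
          4 · (V ⊗ V)                             ≤⟨ ·-monoʳ-≼ 4 (⊗-monoˡ-≼ 0≼V V≼x+s) ⟩
          4 · (V ⊗ (x ⊕ s))                       ≤⟨ ·-monoʳ-≼ 4 (proj₁ (⊗-distribˡ-⊕ V x s)) ⟩
          4 · (V ⊗ x ⊕ V ⊗ s)                     ≈⟨ ×-distrib-+ (V ⊗ x) (V ⊗ s) 4 ⟩
          4 · (V ⊗ x) ⊕ 4 · (V ⊗ s)               ≤⟨ ⊕-mono-≼ ≼-refl (4xy≼x²+4y² V s) ⟩
          4 · (V ⊗ x) ⊕ (V ⊗ V ⊕ 4 · (s ⊗ s))     ≤⟨ ⊕-mono-≼ ≼-refl (⊕-mono-≼ ≼-refl (·-monoʳ-≼ 4 s²≼D²y)) ⟩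
          4 · (V ⊗ x) ⊕ (V ⊗ V ⊕ 4 · (D ⊗ D ⊗ y)) ≤⟨ ⊕-mono-≼ ≼-refl (proj₁ (⊕-comm _ _)) ⟩
          4 · (V ⊗ x) ⊕ (4 · (D ⊗ D ⊗ y) ⊕ V ⊗ V) ≈⟨ ⊕-assoc _ _ _ ⟨
          4 · (V ⊗ x) ⊕ 4 · (D ⊗ D ⊗ y) ⊕ V ⊗ V   ≤⟨ ⊕-mono-≼ (proj₂ (×-distrib-+ (V ⊗ x) (D ⊗ D ⊗ y) 4)) ≼-refl ⟩
          4 · (V ⊗ x ⊕ D ⊗ D ⊗ y) ⊕ V ⊗ V       ∎)

-- Finite sums, sums over pairs, and totals over subsets.

module Sums where

  open import Defs using (ℝ; 0ℝ; ∑)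
  open Real
  open Weight using (_·_; ·-monoʳ-≼; ×-homo-+)
  open CommutativeMonoid ℝ-commutativeMonoid using (∙-congˡ; commutativeSemigroup; sym; trans)
  open import Algebra.Properties.CommutativeSemigroup commutativeSemigroup using (x∙yz≈y∙xz)
  open import Algebra.Properties.CommutativeMonoid.Sum ℝ-commutativeMonoid public
    using (sum; sum-cong-≋; sum-replicate; sum-replicate-zero; ∑-comm; sum-permute)
  open import Algebra.Solver.CommutativeMonoid ℝ-commutativeMonoid
    using (solve; _⊜_; id) renaming (_⊕_ to _⊞_)
  open import Relation.Binary.Reasoning.PartialOrder ≼-poset

  x≼y⊕x : ∀ {x y} → 0ℝ ≼ y → x ≼ y ⊕ x
  x≼y⊕x {x} {y} 0≼y = begin
    x       ≈⟨ ⊕-identityˡ x ⟨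
    0ℝ ⊕ x  ≤⟨ ⊕-mono-≼ 0≼y ≼-refl ⟩
    y ⊕ x   ∎

  ·-nonneg : ∀ k {x} → 0ℝ ≼ x → 0ℝ ≼ k · x
  ·-nonneg zero    0≼x = ≼-refl
  ·-nonneg (suc k) 0≼x = ≼-trans (·-nonneg k 0≼x) (x≼y⊕x 0≼x)

  -- Brings the final comparison back from reals to naturals. If `l < k`, then `k · x` contains
  -- `suc l` copies of `x`, and cancelling `l · x` leaves `x ≼ 0ℝ`.
  ·-cancelʳ-≤ : ∀ {k l x} → 0ℝ ≼ x → ¬ (x ≼ 0ℝ) → k · x ≼ l · x → k ℕ.≤ l
  ·-cancelʳ-≤ {k} {l} {x} 0≼x x⋠0 kx≼lx = ℕₚ.≮⇒≥ λ l<k → x⋠0 (⊕-cancelʳ-≼ (l · x) (begin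
    x ⊕ l · x                               ≤⟨ x≼y⊕x (·-nonneg (k ℕ.∸ suc l) 0≼x) ⟩
    (k ℕ.∸ suc l) · x ⊕ suc l · x           ≈⟨ ×-homo-+ x (k ℕ.∸ suc l) (suc l) ⟨
    (k ℕ.∸ suc l ℕ.+ suc l) · x             ≡⟨ ≡.cong (_· x) (ℕₚ.m∸n+n≡m l<k) ⟩
    k · x                                   ≤⟨ kx≼lx ⟩
    l · x                                   ≈⟨ ⊕-identityˡ (l · x) ⟨
    0ℝ ⊕ l · x                              ∎))

  sum-mono : ∀ {n} {f g : Fin n → ℝ} → (∀ i → f i ≼ g i) → sum f ≼ sum g
  sum-mono {zero}  f≼g = ≼-refl
  sum-mono {suc n} f≼g = ⊕-mono-≼ (f≼g zero) (sum-mono (f≼g ∘ suc))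

  -- Of three terms, each occurs in two of the three pairs; from four on, two terms
  -- are split off.
  sum-pairs : ∀ n {c} (w : Fin (suc (suc n)) → ℝ) → (∀ i j → i ≢ j → c ≼ w i ⊕ w j) →
              suc (suc n) · c ≼ sum w ⊕ sum w
  sum-pairs zero {c} w pairs = begin
    c ⊕ (c ⊕ 0ℝ)                        ≤⟨ ⊕-mono-≼ c≼ (⊕-mono-≼ c≼ ≼-refl) ⟩
    (a ⊕ b) ⊕ ((a ⊕ b) ⊕ 0ℝ)            ≈⟨ solve 2 (λ a b → (a ⊞ b) ⊞ ((a ⊞ b) ⊞ id) ⊜ (a ⊞ (b ⊞ id)) ⊞ (a ⊞ (b ⊞ id)))
                                             (≼-refl , ≼-refl) a b ⟩
    (a ⊕ (b ⊕ 0ℝ)) ⊕ (a ⊕ (b ⊕ 0ℝ))     ∎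
    where
    a = w 0F
    b = w 1F
    c≼ = pairs 0F 1F λ ()
  sum-pairs (suc zero) {c} w pairs = begin
    c ⊕ (c ⊕ (c ⊕ 0ℝ))
      ≤⟨ ⊕-mono-≼ (pairs 0F 1F λ ()) (⊕-mono-≼ (pairs 1F 2F λ ()) (⊕-mono-≼ (pairs 0F 2F λ ()) ≼-refl)) ⟩
    (a ⊕ b) ⊕ ((b ⊕ d) ⊕ ((a ⊕ d) ⊕ 0ℝ))
      ≈⟨ solve 3 (λ a b d → (a ⊞ b) ⊞ ((b ⊞ d) ⊞ ((a ⊞ d) ⊞ id))
           ⊜ (a ⊞ (b ⊞ (d ⊞ id))) ⊞ (a ⊞ (b ⊞ (d ⊞ id)))) (≼-refl , ≼-refl) a b d ⟩
    (a ⊕ (b ⊕ (d ⊕ 0ℝ))) ⊕ (a ⊕ (b ⊕ (d ⊕ 0ℝ))) ∎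
    where
    a = w 0F
    b = w 1F
    d = w 2F
  sum-pairs (suc (suc n)) {c} w pairs = begin
    c ⊕ (c ⊕ suc (suc n) · c)
      ≤⟨ ⊕-mono-≼ c≼ (⊕-mono-≼ c≼ (sum-pairs n w′ λ i j i≢j →
           pairs (suc (suc i)) (suc (suc j)) (i≢j ∘ suc-injective ∘ suc-injective))) ⟩
    (a ⊕ b) ⊕ ((a ⊕ b) ⊕ (sum w′ ⊕ sum w′))
      ≈⟨ solve 3 (λ a b r → (a ⊞ b) ⊞ ((a ⊞ b) ⊞ (r ⊞ r)) ⊜ (a ⊞ (b ⊞ r)) ⊞ (a ⊞ (b ⊞ r)))
           (≼-refl , ≼-refl) a b (sum w′) ⟩
    (a ⊕ (b ⊕ sum w′)) ⊕ (a ⊕ (b ⊕ sum w′)) ∎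
    where
    w′ : Fin (suc (suc n)) → ℝ
    w′ i = w (suc (suc i))
    a = w 0F
    b = w 1F
    c≼ = pairs 0F 1F λ ()

  -- A copy of `∑` over the opaque `⊕`, so that comparing sums never unfolds Cauchy proofs.
  total : ∀ {n} → Subset n → (Fin n → ℝ) → ℝ
  total []            f = 0ℝ
  total (inside  ∷ S) f = f zero ⊕ total S (f ∘ suc)
  total (outside ∷ S) f = total S (f ∘ suc)

  ∑≡total : ∀ {n} (S : Subset n) f → ∑ S f ≡ total S f
  ∑≡total []            f = refl
  ∑≡total (inside  ∷ S) f = ≡.trans +≡⊕ (≡.cong (f zero ⊕_) (∑≡total S (f ∘ suc)))
  ∑≡total (outside ∷ S) f = ∑≡total S (f ∘ suc)

  total-⊥ : ∀ {n} (f : Fin n → ℝ) → total ⊥ f ≡ 0ℝ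
  total-⊥ {zero}  f = refl
  total-⊥ {suc n} f = total-⊥ (f ∘ suc)

  total-⁅⁆ : ∀ {n} (j : Fin n) f → total ⁅ j ⁆ f ≈ f j
  total-⁅⁆ zero    f = begin-equality
    f zero ⊕ total ⊥ (f ∘ suc)  ≡⟨ ≡.cong (f zero ⊕_) (total-⊥ (f ∘ suc)) ⟩
    f zero ⊕ 0ℝ                 ≈⟨ ⊕-identityʳ (f zero) ⟩
    f zero                      ∎
  total-⁅⁆ (suc j) f = total-⁅⁆ j (f ∘ suc)

  total-nonneg : ∀ {n} (S : Subset n) {f} → (∀ j → 0ℝ ≼ f j) → 0ℝ ≼ total S f
  total-nonneg []            f≥0 = ≼-refl
  total-nonneg (inside  ∷ S) f≥0 = ≼-trans (total-nonneg S (f≥0 ∘ suc)) (x≼y⊕x (f≥0 zero))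
  total-nonneg (outside ∷ S) f≥0 = total-nonneg S (f≥0 ∘ suc)

  total-∪ˡ : ∀ {n} (S T : Subset n) {f} → (∀ j → 0ℝ ≼ f j) → total S f ≼ total (S ∪ T) f
  total-∪ˡ []            []            f≥0 = ≼-refl
  total-∪ˡ (inside  ∷ S) (_       ∷ T) f≥0 = ⊕-mono-≼ ≼-refl (total-∪ˡ S T (f≥0 ∘ suc))
  total-∪ˡ (outside ∷ S) (inside  ∷ T) f≥0 = ≼-trans (total-∪ˡ S T (f≥0 ∘ suc)) (x≼y⊕x (f≥0 zero))
  total-∪ˡ (outside ∷ S) (outside ∷ T) f≥0 = total-∪ˡ S T (f≥0 ∘ suc)

  -- Only an inequality, since `j` may already lie in `S`; then nonnegativity absorbs the extra
  -- `f j`. This direction serves both the upper bound on the loads and the lower bound on pairs of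
  -- machines.
  total-insert : ∀ {n} (S : Subset n) j {f} → (∀ j → 0ℝ ≼ f j) → total (S ∪ ⁅ j ⁆) f ≼ f j ⊕ total S f
  total-insert (inside ∷ S) zero {f} f≥0 = begin
    f zero ⊕ total (S ∪ ⊥) (f ∘ suc)    ≡⟨ ≡.cong (λ S → f zero ⊕ total S (f ∘ suc)) (∪-identityʳ S) ⟩
    f zero ⊕ total S (f ∘ suc)          ≤⟨ x≼y⊕x (f≥0 zero) ⟩
    f zero ⊕ total (inside ∷ S) f       ∎
  total-insert (outside ∷ S) zero {f} f≥0 = begin
    f zero ⊕ total (S ∪ ⊥) (f ∘ suc)    ≡⟨ ≡.cong (λ S → f zero ⊕ total S (f ∘ suc)) (∪-identityʳ S) ⟩
    f zero ⊕ total S (f ∘ suc)          ∎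
  total-insert (inside ∷ S) (suc j) {f} f≥0 = begin
    f zero ⊕ total (S ∪ ⁅ j ⁆) (f ∘ suc)         ≤⟨ ⊕-mono-≼ ≼-refl (total-insert S j (f≥0 ∘ suc)) ⟩
    f zero ⊕ (f (suc j) ⊕ total S (f ∘ suc))     ≈⟨ x∙yz≈y∙xz (f zero) (f (suc j)) (total S (f ∘ suc)) ⟩
    f (suc j) ⊕ total (inside ∷ S) f             ∎
  total-insert (outside ∷ S) (suc j) f≥0 = total-insert S j (f≥0 ∘ suc)

  total-tabulate : ∀ {n} (p : Fin n → Bool) f →
                   total (Vec.tabulate p) f ≈ sum (λ j → if p j then f j else 0ℝ)
  total-tabulate {zero}  p f = ≼-refl , ≼-refl
  total-tabulate {suc n} p f with p zero
  ... | true  = ∙-congˡ (total-tabulate (p ∘ suc) (f ∘ suc))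
  ... | false = trans (total-tabulate (p ∘ suc) (f ∘ suc)) (sym (⊕-identityˡ _))

  sum-indicator : ∀ {n} (i : Fin n) x → sum (λ k → if does (i ≟ᶠ k) then x else 0ℝ) ≈ x
  sum-indicator {suc n} zero x = begin-equality
    x ⊕ sum {n} (λ _ → 0ℝ)  ≈⟨ ∙-congˡ (sum-replicate-zero n) ⟩
    x ⊕ 0ℝ                  ≈⟨ ⊕-identityʳ x ⟩
    x                       ∎
  sum-indicator {suc n} (suc i) x = trans (⊕-identityˡ _) (sum-indicator i x)

  -- Double counting: after exchanging the two sums, each `j` contributes at the single index `a j`.
  sum-fibres : ∀ {n k} (a : Fin n → Fin k) f →
               sum (λ i → total (Vec.tabulate λ j → does (a j ≟ᶠ i)) f) ≈ sum f
  sum-fibres a f = begin-equality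
    sum (λ i → total (Vec.tabulate λ j → does (a j ≟ᶠ i)) f)
      ≈⟨ sum-cong-≋ (λ i → total-tabulate (λ j → does (a j ≟ᶠ i)) f) ⟩
    sum (λ i → sum (λ j → if does (a j ≟ᶠ i) then f j else 0ℝ))
      ≈⟨ ∑-comm (λ i j → if does (a j ≟ᶠ i) then f j else 0ℝ) ⟩
    sum (λ j → sum (λ i → if does (a j ≟ᶠ i) then f j else 0ℝ))
      ≈⟨ sum-cong-≋ (λ j → sum-indicator (a j) (f j)) ⟩
    sum f ∎

  total-list : {A : Set} → (A → ℝ) → List A → ℝ
  total-list f = foldr (λ j x → f j ⊕ x) 0ℝ

  total-list-tabulate : ∀ {n} {A : Set} (f : A → ℝ) (g : Fin n → A) →
                        total-list f (tabulate g) ≡ sum (f ∘ g)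
  total-list-tabulate {zero}  f g = refl
  total-list-tabulate {suc n} f g = ≡.cong (f (g zero) ⊕_) (total-list-tabulate f (g ∘ suc))

-- Loads along a lazy run and the comparison with a packing.

module LazyAnalysis where

  open import Defs using (ℝ; seq; 0ℝ; ∑; _<_; _+_; _*_; √_; SMBP; Machines; LazyStep;
    assign; purchase; LazySteps; []; _∷_;
    LazyRun; jobsOn; Servable; module ℚ-Aux)
  open Real
  open Weight
  open Sums
  open ℚ-Aux using (*-pp; *-mono; 0<½; ½ε+½ε; p≤p+q)
  open CommutativeMonoid ℝ-commutativeMonoid using (∙-congˡ)
  open import Algebra.Properties.CommutativeSemigroup
    (CommutativeMonoid.commutativeSemigroup ℝ-commutativeMonoid) using (x∙yz≈y∙xz)
  open import Relation.Binary.Reasoning.PartialOrder ≼-poset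

  positive⇒nonneg : ∀ {x} → 0ℝ < x → 0ℝ ≼ x
  positive⇒nonneg {x} (ε , 0<ε , N , ε≤x) = ⟨ (λ δ 0<δ → N , λ n N≤n →
    ℚₚ.≤-trans (ℚₚ.<⇒≤ (ℚₚ.+-monoʳ-< 0ℚ 0<ε))
      (ℚₚ.≤-trans (ε≤x n N≤n) (p≤p+q (seq x n) (ℚₚ.<⇒≤ 0<δ)))) ⟩

  -- Eventually `x` is at least `ε`, so its square is at least `ε²`, while `x ⊗ x ≼ 0ℝ` at tolerance
  -- `½ ε²` would keep it at most half of that. Applied to `V`, this permits cancelling the unit
  -- `V ⊗ V`.
  positive⇒square⋠0 : ∀ {x} → 0ℝ < x → ¬ (x ⊗ x ≼ 0ℝ)
  positive⇒square⋠0 {x} (ε , 0<ε , N , ε≤x) ⟨ x²≤0 ⟩ = at (x²≤0 (½ ℚ.* (ε ℚ.* ε)) 0<½ε²)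
    where
    0<ε² = *-pp {ε} {ε} 0<ε 0<ε
    0<½ε² = *-pp {½} {ε ℚ.* ε} 0<½ 0<ε²
    at : ¬ ∃ λ M → ∀ n → M ℕ.≤ n → seq (x ⊗ x) n ℚ.≤ 0ℚ ℚ.+ ½ ℚ.* (ε ℚ.* ε)
    at (M , h) = ℚₚ.<-irrefl refl (ℚₚ.<-≤-trans ½ε²<ε² (ℚₚ.≤-trans ε²≤x² x²≤½ε²))
      where
      n = N ℕ.⊔ M
      ε≤xₙ : ε ℚ.≤ seq x n
      ε≤xₙ = ≡.subst (ℚ._≤ seq x n) (ℚₚ.+-identityˡ ε) (ε≤x n (ℕₚ.m≤m⊔n N M))
      ε²≤x² : ε ℚ.* ε ℚ.≤ seq x n ℚ.* seq x n
      ε²≤x² = *-mono {ε} {seq x n} {ε} {seq x n} (ℚₚ.<⇒≤ 0<ε)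
        (ℚₚ.≤-trans (ℚₚ.<⇒≤ 0<ε) ε≤xₙ) ε≤xₙ ε≤xₙ
      x²≤½ε² : seq x n ℚ.* seq x n ℚ.≤ ½ ℚ.* (ε ℚ.* ε)
      x²≤½ε² = ≡.subst₂ ℚ._≤_ (seq-⊗ x x n) (ℚₚ.+-identityˡ (½ ℚ.* (ε ℚ.* ε))) (h n (ℕₚ.m≤n⊔m N M))
      ½ε²<ε² : ½ ℚ.* (ε ℚ.* ε) ℚ.< ε ℚ.* ε
      ½ε²<ε² = ≡.subst₂ ℚ._<_ (ℚₚ.+-identityˡ (½ ℚ.* (ε ℚ.* ε))) (½ε+½ε (ε ℚ.* ε))
        (ℚₚ.+-monoˡ-< (½ ℚ.* (ε ℚ.* ε)) 0<½ε²)

  -- By additivity of the weight, bounds in terms of the two sums over a set become bounds on the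
  -- sum of its job weights.
  total-weight : ∀ V D {n} (S : Subset n) f g →
                 total S (λ j → weight V D (f j) (g j)) ≈ weight V D (total S f) (total S g)
  total-weight V D []            f g = proj₂ (weight-0 V D) , proj₁ (weight-0 V D)
  total-weight V D (outside ∷ S) f g = total-weight V D S (f ∘ suc) (g ∘ suc)
  total-weight V D (inside  ∷ S) f g = begin-equality
    weight V D (f zero) (g zero) ⊕ total S (λ j → weight V D (f (suc j)) (g (suc j)))
      ≈⟨ ∙-congˡ (total-weight V D S (f ∘ suc) (g ∘ suc)) ⟩
    weight V D (f zero) (g zero) ⊕ weight V D (total S (f ∘ suc)) (total S (g ∘ suc))
      ≈⟨ weight-⊕ V D (f zero) (total S (f ∘ suc)) (g zero) (total S (g ∘ suc)) ⟨
    weight V D (f zero ⊕ total S (f ∘ suc)) (g zero ⊕ total S (g ∘ suc)) ∎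

  module _ (I : SMBP) where
    open SMBP I

    jobWeight : Fin N → ℝ
    jobWeight j = weight V D (μ j) (b j)

    0≼V : 0ℝ ≼ V
    0≼V = positive⇒nonneg V>0

    jobWeight-nonneg : ∀ j → 0ℝ ≼ jobWeight j
    jobWeight-nonneg j = weight-nonneg V D 0≼V ⟨ D≥0 ⟩ ⟨ μ≥0 j ⟩ ⟨ b≥0 j ⟩

    load : Subset N → ℝ
    load S = total S jobWeight

    module _ (S : Subset N) where
      private
        x y : ℝ
        x = total S μ
        y = total S b

        0≼x : 0ℝ ≼ x
        0≼x = total-nonneg S (λ j → ⟨ μ≥0 j ⟩)

        0≼y : 0ℝ ≼ y
        0≼y = total-nonneg S (λ j → ⟨ b≥0 j ⟩)

        use : ℝ
        use = ∑ S μ + D * √ (∑ S b)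

        use≈ : use ≈ x ⊕ D ⊗ sqrt y
        use≈ = ≡.subst₂ (λ x y → use ≈ x ⊕ D ⊗ sqrt y) (∑≡total S μ) (∑≡total S b)
          (capacity-use (∑ S μ) D (∑ S b))

      feasible⇒load : Feasible S → load S ≼ 4 · (V ⊗ V)
      feasible⇒load feasible = begin
        load S           ≈⟨ total-weight V D S μ b ⟩
        weight V D x y   ≤⟨ weight-feasible V D 0≼V ⟨ D≥0 ⟩ 0≼x 0≼y (≼-trans (proj₂ use≈) ⟨ feasible ⟩) ⟩
        4 · (V ⊗ V)      ∎

      infeasible⇒load : ¬ Feasible S → 3 · (V ⊗ V) ≼ load S
      infeasible⇒load infeasible = begin
        3 · (V ⊗ V)      ≤⟨ weight-infeasible V D 0≼V ⟨ D≥0 ⟩ 0≼x 0≼y (≼-trans (≰⇒≽ infeasible) (proj₁ use≈)) ⟩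
        weight V D x y   ≈⟨ total-weight V D S μ b ⟨
        load S           ∎

    loads : ∀ {m} → Machines I m → ℝ
    loads M = sum (λ i → load (lookup M i))

    -- The invariant of a lazy run. Ranging over all pairs of distinct machines, it makes no
    -- reference to the order of purchase.
    Crowded : ∀ {m} → Machines I m → Set
    Crowded M = ∀ i j → i ≢ j → 3 · (V ⊗ V) ≼ load (lookup M i) ⊕ load (lookup M j)

    load-update : ∀ {m} (M : Machines I m) i {S} → load (lookup M i) ≼ load S →
                  ∀ k → load (lookup M k) ≼ load (lookup (M [ i ]≔ S) k)
    load-update M i {S} ≼S k with k ≟ᶠ i
    ... | yes refl = ≡.subst (λ T → load (lookup M k) ≼ load T) (≡.sym (lookup∘update k M S)) ≼S
    ... | no k≢i   = ≡.subst (λ T → load (lookup M k) ≼ load T) (≡.sym (lookup∘update′ k≢i M S)) ≼-refl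

    loads-update : ∀ {m} (M : Machines I m) i {S x} → load S ≼ x ⊕ load (lookup M i) →
                   loads (M [ i ]≔ S) ≼ x ⊕ loads M
    loads-update (T ∷ M) zero {S} {x} S≼ = begin
      load S ⊕ loads M          ≤⟨ ⊕-mono-≼ S≼ ≼-refl ⟩
      x ⊕ load T ⊕ loads M      ≈⟨ ⊕-assoc x (load T) (loads M) ⟩
      x ⊕ (load T ⊕ loads M)    ∎
    loads-update (T ∷ M) (suc i) {S} {x} S≼ = begin
      load T ⊕ loads (M [ i ]≔ S)  ≤⟨ ⊕-mono-≼ ≼-refl (loads-update M i S≼) ⟩
      load T ⊕ (x ⊕ loads M)       ≈⟨ x∙yz≈y∙xz (load T) x (loads M) ⟩
      x ⊕ (load T ⊕ loads M)       ∎

    -- The weight of the infeasible union is at most that of its two parts: the old machine and the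
    -- new one, which holds `j` alone.
    crowded-pair : ∀ S j → ¬ Feasible (S ∪ ⁅ j ⁆) → 3 · (V ⊗ V) ≼ load ⁅ j ⁆ ⊕ load S
    crowded-pair S j infeasible = begin
      3 · (V ⊗ V)            ≤⟨ infeasible⇒load (S ∪ ⁅ j ⁆) infeasible ⟩
      load (S ∪ ⁅ j ⁆)       ≤⟨ total-insert S j jobWeight-nonneg ⟩
      jobWeight j ⊕ load S   ≤⟨ ⊕-mono-≼ (proj₂ (total-⁅⁆ j jobWeight)) ≼-refl ⟩
      load ⁅ j ⁆ ⊕ load S    ∎

    -- Assigning a job never decreases a load, as weights are nonnegative. A purchase puts the new
    -- machine at index `zero`, and each new pair contains it together with a machine that could not
    -- take `j`.
    step-crowded : ∀ {j m m′} {M : Machines I m} {M′ : Machines I m′} →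
                   LazyStep I j M M′ → Crowded M → Crowded M′
    step-crowded {j} {M = M} (assign i _) crowded k l k≢l =
      ≼-trans (crowded k l k≢l) (⊕-mono-≼ (grows k) (grows l))
      where grows = load-update M i (total-∪ˡ (lookup M i) ⁅ j ⁆ jobWeight-nonneg)
    step-crowded (purchase _) crowded zero zero 0≢0 = contradiction refl 0≢0
    step-crowded {j} {M = M} (purchase full) crowded zero (suc l) _ =
      crowded-pair (lookup M l) j (full l)
    step-crowded {j} {M = M} (purchase full) crowded (suc k) zero _ =
      ≼-trans (crowded-pair (lookup M k) j (full k)) (proj₁ (⊕-comm (load ⁅ j ⁆) (load (lookup M k))))
    step-crowded (purchase _) crowded (suc k) (suc l) k≢l = crowded k l (k≢l ∘ ≡.cong suc)

    step-loads : ∀ {j m m′} {M : Machines I m} {M′ : Machines I m′} →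
                 LazyStep I j M M′ → loads M′ ≼ jobWeight j ⊕ loads M
    step-loads {j} {M = M} (assign i _)  = loads-update M i (total-insert (lookup M i) j jobWeight-nonneg)
    step-loads {j} {M = M} (purchase _)  = ⊕-mono-≼ (proj₁ (total-⁅⁆ j jobWeight)) ≼-refl

    steps-crowded : ∀ {js m m′} {M : Machines I m} {M′ : Machines I m′} →
                    LazySteps I M js M′ → Crowded M → Crowded M′
    steps-crowded []       = λ crowded → crowded
    steps-crowded (s ∷ ss) = steps-crowded ss ∘ step-crowded s

    steps-loads : ∀ {js m m′} {M : Machines I m} {M′ : Machines I m′} →
                  LazySteps I M js M′ → loads M′ ≼ total-list jobWeight js ⊕ loads M
    steps-loads {M = M} [] = proj₂ (⊕-identityˡ (loads M))
    steps-loads {j ∷ js} {M = M} {M″} (_∷_ {M′ = M′} s ss) = begin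
      loads M″                                              ≤⟨ steps-loads ss ⟩
      total-list jobWeight js ⊕ loads M′                    ≤⟨ ⊕-mono-≼ ≼-refl (step-loads s) ⟩
      total-list jobWeight js ⊕ (jobWeight j ⊕ loads M)     ≈⟨ x∙yz≈y∙xz _ (jobWeight j) (loads M) ⟩
      jobWeight j ⊕ (total-list jobWeight js ⊕ loads M)     ≈⟨ ⊕-assoc (jobWeight j) _ (loads M) ⟨
      total-list jobWeight (j ∷ js) ⊕ loads M               ∎

    -- The arrival order disappears here: the sum over the arrival list is a permutation of the sum
    -- over all jobs, and the run starts with no load.
    run-loads : ∀ π {m} {M : Machines I m} → LazyRun I π M → loads M ≼ sum jobWeight
    run-loads π {M = M} run = begin
      loads M                                            ≤⟨ steps-loads run ⟩
      total-list jobWeight (tabulate (π ⟨$⟩ʳ_)) ⊕ 0ℝ     ≈⟨ ⊕-identityʳ _ ⟩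
      total-list jobWeight (tabulate (π ⟨$⟩ʳ_))          ≡⟨ total-list-tabulate jobWeight (π ⟨$⟩ʳ_) ⟩
      sum (λ t → jobWeight (π ⟨$⟩ʳ t))                   ≈⟨ sum-permute jobWeight π ⟨
      sum jobWeight                                      ∎

    -- The fibres of the assignment partition the jobs into `k` feasible sets, possibly empty, each
    -- of weight at most `4 · (V ⊗ V)`.
    servable⇒sum : ∀ {k} → Servable I k → sum jobWeight ≼ k · 4 · (V ⊗ V)
    servable⇒sum {k} (a , feasible) = begin
      sum jobWeight                      ≈⟨ sum-fibres a jobWeight ⟨
      sum (λ i → load (jobsOn I a i))    ≤⟨ sum-mono (λ i → feasible⇒load (jobsOn I a i) (feasible i)) ⟩
      sum {k} (λ _ → 4 · (V ⊗ V))        ≈⟨ sum-replicate k ⟩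
      k · 4 · (V ⊗ V)                    ∎

    -- Each arrival purchases at most one machine. The bound yields the existence of a job once a
    -- machine has been purchased.
    run-machines : ∀ {js m m′} {M : Machines I m} {M′ : Machines I m′} →
                   LazySteps I M js M′ → m′ ℕ.≤ length js ℕ.+ m
    run-machines [] = ℕₚ.≤-refl
    run-machines (assign _ _ ∷ ss) = ℕₚ.≤-trans (run-machines ss) (ℕₚ.n≤1+n _)
    run-machines {_ ∷ js} {m} (purchase _ ∷ ss) =
      ℕₚ.≤-trans (run-machines ss) (ℕₚ.≤-reflexive (ℕₚ.+-suc (length js) m))

    -- The pair argument needs two machines, so `m = 0` and `m = 1` are treated separately. The
    -- right side is a sum of two equal terms because summing over pairs bounds twice the total
    -- load.
    lazy-bound : ∀ π {k} → Servable I k → ∀ {m} (M : Machines I m) → LazyRun I π M →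
                 m ℕ.* 3 ℕ.≤ k ℕ.* 4 ℕ.+ k ℕ.* 4
    lazy-bound π servable {zero} M run = ℕ.z≤n
    -- One purchased machine means that there is a job, which cannot be assigned to one of zero
    -- machines.
    lazy-bound π {zero} (a , _) {suc zero} M run = contradiction (a job) λ ()
      where
      1≤N : 1 ℕ.≤ N
      1≤N = ≡.subst (1 ℕ.≤_) (≡.trans (ℕₚ.+-identityʳ _) (length-tabulate (π ⟨$⟩ʳ_))) (run-machines run)
      job : Fin N
      job = fromℕ< 1≤N
    lazy-bound π {suc k} servable {suc zero} M run =
      -- Here `3 ≤ 5 + 3`, and 8 is read as `4 + 4`, one 4 for each summand on the right.
      ℕₚ.≤-trans (ℕₚ.m≤n+m 3 5) (ℕₚ.+-mono-≤ (ℕₚ.m≤m+n 4 (k ℕ.* 4)) (ℕₚ.m≤m+n 4 (k ℕ.* 4)))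
    lazy-bound π {k} servable {m@(suc (suc m-2))} M run =
     ·-cancelʳ-≤ (square-nonneg V) (positive⇒square⋠0 V>0) (begin
      (m ℕ.* 3) · U                      ≈⟨ ×-assocˡ U m 3 ⟨
      -- The empty initial state is vacuously `Crowded`.
      m · 3 · U                          ≤⟨ sum-pairs m-2 (λ i → load (lookup M i)) (steps-crowded run λ ()) ⟩
      loads M ⊕ loads M                  ≤⟨ ⊕-mono-≼ loads≼ loads≼ ⟩
      (k ℕ.* 4) · U ⊕ (k ℕ.* 4) · U      ≈⟨ ×-homo-+ U (k ℕ.* 4) (k ℕ.* 4) ⟨
      (k ℕ.* 4 ℕ.+ k ℕ.* 4) · U          ∎)
      where
      U = V ⊗ V
      loads≼ : loads M ≼ (k ℕ.* 4) · U
      loads≼ = begin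
        loads M           ≤⟨ run-loads π run ⟩
        sum jobWeight     ≤⟨ servable⇒sum servable ⟩
        k · 4 · U         ≈⟨ ×-assocˡ U k 4 ⟩
        (k ℕ.* 4) · U     ∎

open import Defs using (SMBP; IsOPT; Machines; LazyRun)
open import Data.Nat.Base using (_*_; _≤_)

theorem2 : (I : SMBP) (π : Permutation′ (SMBP.N I))
    (opt : ℕ) → IsOPT I opt →
    ∀ {m} (M : Machines I m) → LazyRun I π M →
    3 * m ≤ 8 * opt
theorem2 I π opt (servable , _) {m} M run =
  ≡.subst₂ _≤_ (ℕₚ.*-comm m 3)
    (≡.trans (≡.sym (ℕₚ.*-distribˡ-+ opt 4 4)) (ℕₚ.*-comm opt 8))
    (LazyAnalysis.lazy-bound I π servable M run)
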